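{- Let $G$ and $G'$ be structures over the same vocabulary with maximum relation arity $2$. If $G$ and $G'$ are non-isomorphic and have the same order $n$, then $\mathrm{D}_1(G,G')\le (n+3)/2$.
   Context: A vocabulary is a finite sequence of relation symbols with positive integer arities; maximum relation arity $2$ means that all symbols are unary or binary (binary relations are arbitrary, loops allowed). Structures are finite; the order of a structure is the number of elements of its universe. First order formulas use the relation symbols of the vocabulary, $=$, and the connectives $\neg,\wedge,\vee$. A closed formula $\Phi$ distinguishes $G$ from $G'$ if it is true on $G$ and false on $G'$. The set $\mathrm{Nest}(\Phi)$ of sequences of nested quantifiers is defined inductively: $\mathrm{Nest}(\Phi)=\{\epsilon\}$ (the empty word) for atomic $\Phi$; $\mathrm{Nest}(\neg\Phi)$ is obtained from $\mathrm{Nest}(\Phi)$ by exchanging $\exists$ and $\forall$ in all words; $\mathrm{Nest}(\Phi\wedge\Psi)=\mathrm{Nest}(\Phi\vee\Psi)=\mathrm{Nest}(\Phi)\cup\mathrm{Nest}(\Psi)$; $\mathrm{Nest}(\exists x\Phi)$ and $\mathrm{Nest}(\forall x\Phi)$ are obtained by prepending $\exists$, respectively $\forall$, to every word of $\mathrm{Nest}(\Phi)$. The quantifier rank of $\Phi$ is the maximum length of a word in $\mathrm{Nest}(\Phi)$; the alternation number of $\Phi$ is the maximum, over words in $\mathrm{Nest}(\Phi)$, of the number of occurrences of $\exists\forall$ and $\forall\exists$ as consecutive letters. $\mathrm{D}_1(G,G')$ is the minimum quantifier rank of a formula with alternation number at most $1$ distinguishing $G$ from $G'$. -}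

module Defs where

open import Data.Bool using (Bool; T)
open import Data.Fin using (Fin)
open import Data.List using (List; []; _∷_; _++_; map; length)
open import Data.List.Extrema.Nat using (max)
open import Data.Nat using (ℕ; zero; suc; _≤_; NonZero)
open import Data.Product using (Σ-syntax; ∃-syntax; _×_)
open import Data.Sum using (_⊎_)
open import Data.Vec as Vec using (Vec; []; _∷_; lookup)
open import Function.Bundles using (_↔_; Inverse)
open import Relation.Binary.PropositionalEquality using (_≡_)
open import Relation.Nullary using (¬_)

record Vocabulary : Set where
  field
    size     : ℕ
    arity    : Fin size → ℕ
    positive : ∀ R → NonZero (arity R)

open Vocabulary public

-- The universe of a structure of order n is Fin n.  Relations are
-- Bool-valued, so that truth of a formula in a structure is decidable.
record Structure (V : Vocabulary) (n : ℕ) : Set where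
  field
    rel : (R : Fin (size V)) → Vec (Fin n) (arity V R) → Bool

open Structure public

record Isomorphism {V : Vocabulary} {m n : ℕ}
                   (G : Structure V m) (G′ : Structure V n) : Set where
  field
    bijection : Fin m ↔ Fin n
    preserves : ∀ R xs → rel G R xs ≡ rel G′ R (Vec.map (Inverse.to bijection) xs)

-- Well-scoped de Bruijn syntax: the free variables of a Formula V k are
-- among k variables, and index zero is the one bound most recently.
data Formula (V : Vocabulary) : ℕ → Set where
  _≈_     : ∀ {k} → Fin k → Fin k → Formula V k
  atom    : ∀ {k} (R : Fin (size V)) → Vec (Fin k) (arity V R) → Formula V k
  neg     : ∀ {k} → Formula V k → Formula V k
  _and_   : ∀ {k} → Formula V k → Formula V k → Formula V k
  _or_    : ∀ {k} → Formula V k → Formula V k → Formula V k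
  exists′ : ∀ {k} → Formula V (suc k) → Formula V k
  forall′ : ∀ {k} → Formula V (suc k) → Formula V k

ClosedFormula : Vocabulary → Set
ClosedFormula V = Formula V zero

Sat : ∀ {V n k} → Structure V n → Vec (Fin n) k → Formula V k → Set
Sat G ρ (x ≈ y)     = lookup ρ x ≡ lookup ρ y
Sat G ρ (atom R xs) = T (rel G R (Vec.map (lookup ρ) xs))
Sat G ρ (neg Φ)     = ¬ Sat G ρ Φ
Sat G ρ (Φ and Ψ)   = Sat G ρ Φ × Sat G ρ Ψ
Sat G ρ (Φ or Ψ)    = Sat G ρ Φ ⊎ Sat G ρ Ψ
Sat G ρ (exists′ Φ) = ∃[ a ] Sat G (a ∷ ρ) Φ
Sat G ρ (forall′ Φ) = ∀ a → Sat G (a ∷ ρ) Φ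

_⊨_ : ∀ {V n} → Structure V n → ClosedFormula V → Set
G ⊨ Φ = Sat G [] Φ

Distinguishes : ∀ {V m n} → ClosedFormula V → Structure V m → Structure V n → Set
Distinguishes Φ G G′ = G ⊨ Φ × ¬ (G′ ⊨ Φ)

data Quantifier : Set where
  E A : Quantifier

exchange : Quantifier → Quantifier
exchange E = A
exchange A = E

Word : Set
Word = List Quantifier

-- The finite set Nest(Φ), listed (possibly with repetitions).  The list is
-- never empty, so the default value 0 in the maxima below plays no role.
Nest : ∀ {V k} → Formula V k → List Word
Nest (x ≈ y)     = [] ∷ []
Nest (atom R xs) = [] ∷ []
Nest (neg Φ)     = map (map exchange) (Nest Φ)
Nest (Φ and Ψ)   = Nest Φ ++ Nest Ψ
Nest (Φ or Ψ)    = Nest Φ ++ Nest Ψ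
Nest (exists′ Φ) = map (E ∷_) (Nest Φ)
Nest (forall′ Φ) = map (A ∷_) (Nest Φ)

alternations : Word → ℕ
alternations []          = 0
alternations (q ∷ [])    = 0
alternations (E ∷ E ∷ w) = alternations (E ∷ w)
alternations (E ∷ A ∷ w) = suc (alternations (A ∷ w))
alternations (A ∷ E ∷ w) = suc (alternations (E ∷ w))
alternations (A ∷ A ∷ w) = alternations (A ∷ w)

quantifierRank : ∀ {V k} → Formula V k → ℕ
quantifierRank Φ = max 0 (map length (Nest Φ))

alternationNumber : ∀ {V k} → Formula V k → ℕ
alternationNumber Φ = max 0 (map alternations (Nest Φ))

-- IsD i G G′ d says that Dᵢ(G,G′) is defined and equal to d.  Minima of
-- arbitrary sets of naturals are not computable, hence a relation.
record IsD (i : ℕ) {V : Vocabulary} {m n : ℕ}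
           (G : Structure V m) (G′ : Structure V n) (d : ℕ) : Set where
  field
    attained : Σ[ Φ ∈ ClosedFormula V ]
                 (alternationNumber Φ ≤ i × Distinguishes Φ G G′ × quantifierRank Φ ≡ d)
    minimal  : ∀ (Φ : ClosedFormula V) →
                 alternationNumber Φ ≤ i → Distinguishes Φ G G′ → d ≤ quantifierRank Φ

{-# OPTIONS --safe #-}
module Submission where

-- Let X be a set of k elements of G.  Its type classes are the classes of
-- elements with the same relations to X.  Extend X by single elements as
-- long as this creates two new classes; then there are at least 2k + 1
-- classes, and at the end no element x of a class with two or more members
-- distinguishes two members, other than x, of any class.  Spoiler first
-- plays X in G.  If some class has different sizes in G and G′, then one
-- class is larger in G and another one in G′; in the cheaper of the two
-- Spoiler plays one element more than the opponent has, and this is cheap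
-- because there are many classes.  If all class sizes agree, then by the choice of X the answer z′ to
-- z survives one more move in G′ exactly when z and z′ have the same
-- profile.  If the profiles are unbalanced then they are so within one
-- class, and outnumbering followed by one move in G′ is again cheap.
-- Otherwise a bijection respecting profiles is an isomorphism.

open import Defs
open import Data.Bool using (Bool; true; false; T)
import Data.Bool.Properties as Boolₚ
open import Data.Empty using (⊥-elim)
open import Data.Fin as Fin using (Fin)
open import Data.Fin.Properties as Finₚ using (any?; all?; injective⇒≤)
open import Data.List as List using (List; []; _∷_; _++_; map; length; filter; allFin)
open import Data.List.Extrema.Nat using (max≤v⁺; xs≤max)
open import Data.List.Membership.Propositional using (_∈_; find)
open import Data.List.Membership.Propositional.Properties
  using (∈-∃++; ∈-lookup; ∈-allFin; ∈-filter⁺; ∈-filter⁻; ∈-map⁺; ∈-map⁻; ∈-++⁻; ∈-++⁺ˡ;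
         ∈-concat⁺′; ∈-cartesianProductWith⁺)
import Data.List.Properties as Listₚ
open import Data.List.Relation.Binary.Permutation.Propositional
  using (_↭_; prep; ↭-trans; ↭-refl; ↭⇒↭ₛ)
open import Data.List.Relation.Binary.Permutation.Propositional.Properties
  using (shift; ↭-length; filter-↭)
import Data.List.Relation.Binary.Permutation.Setoid.Properties as Permutationₛ
open import Data.List.Relation.Binary.Subset.Propositional using (_⊆_)
open import Data.List.Relation.Unary.All as All using (All; []; _∷_)
import Data.List.Relation.Unary.All.Properties as Allₚ
open import Data.List.Relation.Unary.AllPairs as AllPairs using ([]; _∷_)
import Data.List.Relation.Unary.AllPairs.Properties as AllPairsₚ
open import Data.List.Relation.Unary.Any as Any using (here; there)
import Data.List.Relation.Unary.Any.Properties as Anyₚ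
open import Data.List.Relation.Unary.Unique.Propositional using (Unique)
import Data.List.Relation.Unary.Unique.Propositional.Properties as Uniqueₚ
open import Data.Maybe using (Maybe; just; nothing)
import Data.Maybe.Properties as Maybeₚ
open import Data.Nat as ℕ using (ℕ; zero; suc; _+_; _*_; _∸_; _≤_; _<_; z≤n; s≤s; _≤?_; NonZero)
open import Data.Nat.Properties as ℕₚ
  using (≤-trans; ≤-refl; ≤-reflexive; m≤n⇒m≤1+n; suc-injective)
open import Data.Nat.Solver using (module +-*-Solver)
open import Data.Product using (Σ-syntax; ∃-syntax; _×_; _,_; proj₁; proj₂)
import Data.Product.Properties as ×ₚ
open import Data.Sum using (_⊎_; inj₁; inj₂; [_,_]′)
open import Data.Vec as Vec using (Vec; []; _∷_; lookup)
import Data.Vec.Properties as Vecₚ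
open import Function using (_∘_; id)
open import Function.Bundles using (_↔_; Inverse; Equivalence; mk↔ₛ′)
open import Function.Definitions using (Injective)
open import Relation.Binary.Definitions using (DecidableEquality)
open import Relation.Binary.PropositionalEquality
open import Relation.Nullary using (¬_; Dec; yes; no; contradiction; ¬?)
open import Relation.Nullary.Decidable
  using (map′; _×-dec_; _⊎-dec_; does; T?; decidable-stable)

-- Lists and fibres

private variable
  I I′ K : Set
  n     : ℕ

lookup-injective : {xs : List I} → Unique xs → ∀ i j →
  List.lookup xs i ≡ List.lookup xs j → i ≡ j
lookup-injective (x∉ ∷ u) Fin.zero    Fin.zero    e = refl
lookup-injective (x∉ ∷ u) Fin.zero    (Fin.suc j) e = ⊥-elim (All.lookup x∉ (∈-lookup j) e)
lookup-injective (x∉ ∷ u) (Fin.suc i) Fin.zero    e = ⊥-elim (All.lookup x∉ (∈-lookup i) (sym e))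
lookup-injective (x∉ ∷ u) (Fin.suc i) (Fin.suc j) e = cong Fin.suc (lookup-injective u i j e)

Unique-⊆-length : {xs ys : List I} → Unique xs → xs ⊆ ys → length xs ≤ length ys
Unique-⊆-length {xs = xs} {ys} u sub = injective⇒≤ {f = position} injective
  where
  position : Fin (length xs) → Fin (length ys)
  position i = Any.index (sub (∈-lookup i))

  lookup-position : ∀ i → List.lookup xs i ≡ List.lookup ys (position i)
  lookup-position i = Anyₚ.lookup-index (sub (∈-lookup i))

  injective : Injective _≡_ _≡_ position
  injective {i} {j} e = lookup-injective u i j
    (trans (lookup-position i) (trans (cong (List.lookup ys) e) (sym (lookup-position j))))

Unique-length≤ : ∀ {n} {xs : List (Fin n)} → Unique xs → length xs ≤ n
Unique-length≤ {n} u =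
  ≤-trans (Unique-⊆-length u (λ {x} _ → ∈-allFin x)) (≤-reflexive (Listₚ.length-tabulate id))

module Fibres (_≟_ : DecidableEquality K) where

  fibre : (I → K) → K → List I → List I
  fibre f τ = filter (λ x → f x ≟ τ)

  # : (I → K) → K → List I → ℕ
  # f τ xs = length (fibre f τ xs)

  #-∷-mono : (f : I → K) (g : I′ → K) {x : I} {y : I′} {xs : List I} {ys : List I′} →
    f x ≡ g y → ∀ τ → # g τ ys < # f τ xs → # g τ (y ∷ ys) < # f τ (x ∷ xs)
  #-∷-mono f g {x} {y} e τ l with f x ≟ τ | g y ≟ τ
  ... | yes _ | yes _ = s≤s l
  ... | yes p | no ¬q = contradiction (trans (sym e) p) ¬q
  ... | no ¬p | yes q = contradiction (trans e q) ¬p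
  ... | no _  | no _  = l

  #-↭ : (f : I → K) → ∀ τ {xs ys} → xs ↭ ys → # f τ xs ≡ # f τ ys
  #-↭ f τ perm = ↭-length (filter-↭ (λ x → f x ≟ τ) perm)

  -- A key-preserving bijection between the two lists, stored as a reordering of `ys` that shows the
  -- keys in the order of `xs`.
  Matched : (I → K) → (I′ → K) → List I → List I′ → Set
  Matched f g xs ys = Σ[ zs ∈ List _ ] (ys ↭ zs × map f xs ≡ map g zs)

  -- Greedy: each `x` takes some `y` with its key out of `ys`. If there is none, the key of `x` is
  -- in excess, and putting back the pairs removed earlier, whose keys agree, keeps the inequality
  -- strict.
  match : (f : I → K) (g : I′ → K) (xs : List I) (ys : List I′) → length xs ≡ length ys →
    Matched f g xs ys ⊎ (∃[ τ ] # g τ ys < # f τ xs)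
  match f g []       []       e = inj₁ ([] , ↭-refl , refl)
  match f g (x ∷ xs) ys e with Any.any? (λ y → g y ≟ f x) ys
  ... | no none = inj₂ (f x , subst₂ _<_
            (cong length (sym (Listₚ.filter-none (λ y → g y ≟ f x) (Allₚ.¬Any⇒All¬ ys none))))
            (cong length (sym (Listₚ.filter-accept (λ y → f y ≟ f x) refl)))
            (s≤s z≤n))
  ... | yes some with find some
  ... | y , y∈ , gy≡fx with ∈-∃++ y∈
  ... | as , bs , refl with match f g xs (as ++ bs)
                              (suc-injective (trans e (↭-length (shift y as bs))))
  ...   | inj₁ (zs , perm , eq) =
            inj₁ (y ∷ zs , ↭-trans (shift y as bs) (prep y perm) , cong₂ _∷_ (sym gy≡fx) eq)
  ...   | inj₂ (τ , lt) = inj₂ (τ , ≤-trans (s≤s (≤-reflexive (#-↭ g τ (shift y as bs))))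
                                     (#-∷-mono f g (sym gy≡fx) τ lt))

  #-map : (f : I → K) (g : I′ → K) → ∀ τ xs ys → map f xs ≡ map g ys → # f τ xs ≡ # g τ ys
  #-map f g τ []       []       e = refl
  #-map f g τ (x ∷ xs) (y ∷ ys) e
    with f x ≟ τ | g y ≟ τ | Listₚ.∷-injective e
  ... | yes _ | yes _ | _ , es = cong suc (#-map f g τ xs ys es)
  ... | yes p | no ¬q | e₀ , _ = contradiction (trans (sym e₀) p) ¬q
  ... | no ¬p | yes q | e₀ , _ = contradiction (trans e₀ q) ¬p
  ... | no _  | no _  | _ , es = #-map f g τ xs ys es

  Matched⇒#≡ : {f : I → K} {g : I′ → K} {xs : List I} {ys : List I′} →
    Matched f g xs ys → ∀ τ → # f τ xs ≡ # g τ ys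
  Matched⇒#≡ {f = f} {g} {xs} (zs , perm , eq) τ =
    trans (#-map f g τ xs zs eq) (sym (#-↭ g τ perm))

  -- `match` is run in both directions; a matching found in one of them rules out an excess in the
  -- other.
  balance : (f : I → K) (g : I′ → K) (xs : List I) (ys : List I′) → length xs ≡ length ys →
    Matched f g xs ys ⊎ ((∃[ τ ] # g τ ys < # f τ xs) × (∃[ τ ] # f τ xs < # g τ ys))
  balance f g xs ys e with match f g xs ys e | match g f ys xs (sym e)
  ... | inj₁ m        | _             = inj₁ m
  ... | inj₂ (τ , lt) | inj₁ m        = contradiction lt (ℕₚ.<-irrefl (Matched⇒#≡ m τ))
  ... | inj₂ τ₁       | inj₂ τ₂       = inj₂ (τ₁ , τ₂)

tabulate-injective : ∀ {n} {f g : Fin n → I} → List.tabulate f ≡ List.tabulate g → f ≗ g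
tabulate-injective {n = suc n} e Fin.zero    = Listₚ.∷-injectiveˡ e
tabulate-injective {n = suc n} e (Fin.suc i) = tabulate-injective (Listₚ.∷-injectiveʳ e) i

map-allFin⇒≗ : ∀ {n} {f : Fin n → K} {g : I → K} (xs : List I) → Unique xs → length xs ≡ n →
  map f (allFin n) ≡ map g xs → Σ[ π ∈ (Fin n → I) ] (Injective _≡_ _≡_ π × (∀ u → g (π u) ≡ f u))
map-allFin⇒≗ {f = f} {g} xs u refl e =
  List.lookup xs , (λ {i} {j} → lookup-injective u i j) , λ i → sym (tabulate-injective
    (trans (sym (Listₚ.map-tabulate id f))
    (trans e (trans (cong (map g) (sym (Listₚ.tabulate-lookup xs)))
                    (Listₚ.map-tabulate (List.lookup xs) g)))) i)

module _ (_≟_ : DecidableEquality K) where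
  open Fibres _≟_

  Matched⇒injection : ∀ {n} {f g : Fin n → K} → Matched f g (allFin n) (allFin n) →
    Σ[ π ∈ (Fin n → Fin n) ] (Injective _≡_ _≡_ π × (∀ u → g (π u) ≡ f u))
  Matched⇒injection {n} (zs , perm , e) =
    map-allFin⇒≗ zs (Permutationₛ.Unique-resp-↭ (setoid (Fin n)) (↭⇒↭ₛ perm) (Uniqueₚ.allFin⁺ n))
      (trans (sym (↭-length perm)) (Listₚ.length-tabulate id)) e

empty-or-inhabited : ∀ n → ¬ Fin n ⊎ Fin n
empty-or-inhabited zero    = inj₁ λ ()
empty-or-inhabited (suc n) = inj₂ Fin.zero

filter-filter-⊆ : {X : Set} {P Q : X → Set} (P? : ∀ x → Dec (P x)) (Q? : ∀ x → Dec (Q x)) →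
  (∀ {x} → P x → Q x) → ∀ xs → filter P? (filter Q? xs) ≡ filter P? xs
filter-filter-⊆ P? Q? sub [] = refl
filter-filter-⊆ P? Q? sub (x ∷ xs) with Q? x
filter-filter-⊆ P? Q? sub (x ∷ xs) | yes q with P? x
... | yes _ = cong (x ∷_) (filter-filter-⊆ P? Q? sub xs)
... | no  _ = filter-filter-⊆ P? Q? sub xs
filter-filter-⊆ P? Q? sub (x ∷ xs) | no ¬q with P? x
... | yes px = contradiction (sub px) ¬q
... | no  _  = filter-filter-⊆ P? Q? sub xs

Unique-map-injective : {X : Set} (f : X → K) {xs : List X} {x y : X} → Unique (map f xs) →
  x ∈ xs → y ∈ xs → f x ≡ f y → x ≡ y
Unique-map-injective f (a ∷ u) (here refl) (here refl) e = refl
Unique-map-injective f (a ∷ u) (here refl) (there y∈)  e = ⊥-elim (All.lookup a (∈-map⁺ f y∈) e)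
Unique-map-injective f (a ∷ u) (there x∈)  (here refl) e = ⊥-elim (All.lookup a (∈-map⁺ f x∈) (sym e))
Unique-map-injective f (a ∷ u) (there x∈)  (there y∈)  e = Unique-map-injective f u x∈ y∈ e

-- Transversals of fibres and counting

module Transversals (_≟_ : DecidableEquality K) where
  open import Data.List.Membership.DecPropositional _≟_ using (_∈?_)

  Transversal : (Fin n → K) → List (Fin n) → Set
  Transversal f L = Unique (map f L) × (∀ u → f u ∈ map f L)

  extend : (f : Fin n → K) (zs L : List (Fin n)) → Unique (map f L) →
    Σ[ L′ ∈ List (Fin n) ] (Unique (map f L′) × length L ≤ length L′ ×
      (∀ {t} → t ∈ map f L → t ∈ map f L′) × (∀ {z} → z ∈ zs → f z ∈ map f L′))
  extend f []       L u = L , u , ≤-refl , id , λ ()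
  extend f (z ∷ zs) L u with f z ∈? map f L
  ... | yes z∈ with extend f zs L u
  ...   | L′ , u′ , l , old , new =
          L′ , u′ , l , old , λ { (here refl) → old z∈ ; (there w∈) → new w∈ }
  extend f (z ∷ zs) L u | no z∉
    with extend f zs (z ∷ L) (Allₚ.¬Any⇒All¬ _ z∉ ∷ u)
  ...   | L′ , u′ , l , old , new =
          L′ , u′ , ≤-trans (ℕₚ.n≤1+n _) l , old ∘ there ,
          λ { (here refl) → old (here refl) ; (there w∈) → new w∈ }

  transversal : (f : Fin n → K) (L : List (Fin n)) → Unique (map f L) →
    Σ[ L′ ∈ List (Fin n) ] (Transversal f L′ × length L ≤ length L′)
  transversal f L u with extend f (allFin _) L u
  ... | L′ , u′ , l , _ , all = L′ , (u′ , λ v → all (∈-allFin v)) , l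

  Unique-avoid : (f : Fin n → K) (τ : K) (L : List (Fin n)) → Unique (map f L) →
    length L ≤ suc (length (filter (λ u → ¬? (f u ≟ τ)) L))
  Unique-avoid f τ []      u = z≤n
  Unique-avoid f τ (x ∷ L) (x∉ ∷ u) with f x ≟ τ
  ... | no _  = s≤s (Unique-avoid f τ L u)
  ... | yes e = s≤s (≤-reflexive (cong length (sym (Listₚ.filter-all (λ u → ¬? (f u ≟ τ))
                  (All.map (λ ne e′ → ne (trans e (sym e′))) (Allₚ.map⁻ x∉))))))

  open Fibres _≟_

  -- Laid end to end, the two fibres and `L` form a list without repetitions in `Fin n`.
  two-fibres : (f : Fin n → K) {τ₁ τ₂ : K} → τ₁ ≢ τ₂ → (L : List (Fin n)) → Unique L →
    All (λ u → f u ≢ τ₁ × f u ≢ τ₂) L → # f τ₁ (allFin n) + # f τ₂ (allFin n) + length L ≤ n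
  two-fibres {n} f {τ₁} {τ₂} ne L u avoid = begin
    length F₁ + length F₂ + length L    ≡⟨ cong (_+ length L) (Listₚ.length-++ F₁) ⟨
    length (F₁ ++ F₂) + length L        ≡⟨ Listₚ.length-++ (F₁ ++ F₂) ⟨
    length ((F₁ ++ F₂) ++ L)            ≤⟨ Unique-length≤ (Uniqueₚ.++⁺ unique₁₂ u disjoint) ⟩
    n                                   ∎
    where
    open ℕₚ.≤-Reasoning
    F₁ = fibre f τ₁ (allFin n)
    F₂ = fibre f τ₂ (allFin n)
    in-fibre : ∀ {τ v} → v ∈ fibre f τ (allFin n) → f v ≡ τ
    in-fibre {τ} v∈ = proj₂ (∈-filter⁻ (λ x → f x ≟ τ) {xs = allFin n} v∈)
    unique₁₂ : Unique (F₁ ++ F₂)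
    unique₁₂ = Uniqueₚ.++⁺ (Uniqueₚ.filter⁺ _ (Uniqueₚ.allFin⁺ n))
      (Uniqueₚ.filter⁺ _ (Uniqueₚ.allFin⁺ n))
      (λ (v₁ , v₂) → ne (trans (sym (in-fibre v₁)) (in-fibre v₂)))
    disjoint : ∀ {v} → ¬ (v ∈ F₁ ++ F₂ × v ∈ L)
    disjoint (v₁₂ , v∈) with ∈-++⁻ F₁ v₁₂ | All.lookup avoid v∈
    ... | inj₁ v₁ | n₁ , _ = n₁ (in-fibre v₁)
    ... | inj₂ v₂ | _ , n₂ = n₂ (in-fibre v₂)

injective⇒↔ : ∀ {n} (π : Fin n → Fin n) → Injective _≡_ _≡_ π →
  Σ[ φ ∈ Fin n ↔ Fin n ] (∀ u → Inverse.to φ u ≡ π u)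
injective⇒↔ {n} π inj =
  mk↔ₛ′ π (proj₁ ∘ preimage) (proj₂ ∘ preimage) (λ u → inj (proj₂ (preimage (π u)))) ,
  λ _ → refl
  where
  preimage : ∀ v → ∃[ u ] π u ≡ v
  preimage v with any? (λ u → π u Fin.≟ v)
  ... | yes found = found
  -- A missed `v` in front of the image would give `n + 1` distinct elements of `Fin n`.
  ... | no none = contradiction
    (Unique-length≤ {xs = v ∷ map π (allFin n)}
      (Allₚ.map⁺ (All.tabulate (λ {u} _ e → none (u , sym e))) ∷ Uniqueₚ.map⁺ inj (Uniqueₚ.allFin⁺ n)))
    (ℕₚ.<⇒≱ (s≤s (≤-reflexive (sym
      (trans (Listₚ.length-map π (allFin n)) (Listₚ.length-tabulate id))))))

-- This turns the arity bound into the fact that an atom concerns one pair of elements; a unary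
-- tuple uses its element twice.
factor : ∀ {k m} → m ≤ 2 → NonZero m → (xs : Vec (Fin k) m) →
  ∃[ i ] ∃[ j ] Σ[ ys ∈ Vec (Fin 2) m ] xs ≡ Vec.map (lookup (i ∷ j ∷ [])) ys
factor _ _ (i ∷ [])     = i , i , Fin.zero ∷ [] , refl
factor _ _ (i ∷ j ∷ []) = i , j , Fin.zero ∷ Fin.suc Fin.zero ∷ [] , refl
factor (s≤s (s≤s ())) _ (_ ∷ _ ∷ _ ∷ _)

map-pair : ∀ {X Y : Set} {m} (f : X → Y) (x x′ : X) (ys : Vec (Fin 2) m) →
  Vec.map f (Vec.map (lookup (x ∷ x′ ∷ [])) ys) ≡ Vec.map (lookup (f x ∷ f x′ ∷ [])) ys
map-pair f x x′ ys = trans (sym (Vecₚ.map-∘ f (lookup (x ∷ x′ ∷ [])) ys))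
  (Vecₚ.map-cong (λ i → sym (Vecₚ.lookup-map i f (x ∷ x′ ∷ []))) ys)

vectors : ∀ k m → List (Vec (Fin k) m)
vectors k zero    = [] ∷ []
vectors k (suc m) = List.cartesianProductWith _∷_ (allFin k) (vectors k m)

∈-vectors : ∀ {k m} (xs : Vec (Fin k) m) → xs ∈ vectors k m
∈-vectors []       = here refl
∈-vectors (x ∷ xs) = ∈-cartesianProductWith⁺ _∷_ (∈-allFin x) (∈-vectors xs)

map-≡⇒≗ : ∀ {X Y : Set} {f g : X → Y} {xs : List X} → map f xs ≡ map g xs → ∀ {x} → x ∈ xs → f x ≡ g x
map-≡⇒≗ e (here refl) = Listₚ.∷-injectiveˡ e
map-≡⇒≗ e (there x∈)  = map-≡⇒≗ (Listₚ.∷-injectiveʳ e) x∈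

does-≡ : {P Q : Set} (P? : Dec P) (Q? : Dec Q) → does P? ≡ does Q? → P → Q
does-≡ (yes _) (yes q) e p = q
does-≡ (no ¬p) _       e p = contradiction p ¬p

≡-does : {P Q : Set} (P? : Dec P) (Q? : Dec Q) → (P → Q) → (Q → P) → does P? ≡ does Q?
≡-does (yes _) (yes _) f g = refl
≡-does (yes p) (no ¬q) f g = contradiction (f p) ¬q
≡-does (no ¬p) (yes q) f g = contradiction (g q) ¬p
≡-does (no _)  (no _)  f g = refl

-- The Ehrenfeucht game with bounded alternation

cost : Maybe Quantifier → Quantifier → ℕ
cost nothing  q = 0
cost (just E) E = 0
cost (just E) A = 1
cost (just A) E = 1
cost (just A) A = 0

module Game {n : ℕ} {Col : Set} (_≟_ : DecidableEquality Col)
            (c : Quantifier → Fin n → Fin n → Col) where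

  -- A pair of pebbled elements, the first in G and the second in G′.
  -- The sides G and G′ are named E and A, after the quantifier with which
  -- Spoiler moves there.
  Pair : Set
  Pair = Fin n × Fin n

  side : Quantifier → Pair → Fin n
  side E = proj₁
  side A = proj₂

  pair : Quantifier → Fin n → Fin n → Pair
  pair E a b = a , b
  pair A a b = b , a

  Diff : ∀ {k} → Vec Pair k → Set
  Diff p = ∃[ i ] ∃[ j ] c E (proj₁ (lookup p i)) (proj₁ (lookup p j))
                       ≢ c A (proj₂ (lookup p i)) (proj₂ (lookup p j))

  Diff? : ∀ {k} (p : Vec Pair k) → Dec (Diff p)
  Diff? p = any? λ i → any? λ j → ¬? (_ ≟ _)

  -- Spoiler wins from p within r rounds and i alternations when the move
  -- before was m.
  data Win (m : Maybe Quantifier) (i : ℕ) : (r : ℕ) {k : ℕ} → Vec Pair k → Set where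
    diff : ∀ {r k} {p : Vec Pair k} → Diff p → Win m i r p
    move : ∀ {r k} {p : Vec Pair k} q {j} → cost m q + j ≤ i → ∀ a →
           (∀ b → Win (just q) j r (pair q a b ∷ p)) → Win m i (suc r) p

  Win-≤ : ∀ {m i i′ r r′ k} {p : Vec Pair k} → i ≤ i′ → r ≤ r′ → Win m i r p → Win m i′ r′ p
  Win-≤ h l       (diff d)       = diff d
  Win-≤ h (s≤s l) (move q g a w) = move q (≤-trans g h) a (λ b → Win-≤ ≤-refl l (w b))

  Win-nothing : ∀ {m i r k} {p : Vec Pair k} → Win m i r p → Win nothing i r p
  Win-nothing (diff d)       = diff d
  Win-nothing (move q g a w) = move q (≤-trans (ℕₚ.m≤n+m _ _) g) a w

  -- Changing the previous move changes the cost of the next one by at most 1. This lets Spoiler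
  -- turn to G′ after playing in G.
  Win-exchange : ∀ {i r k} {p : Vec Pair k} → Win (just A) i r p → Win (just E) (suc i) r p
  Win-exchange (diff d)       = diff d
  Win-exchange (move E g a w) = move E (m≤n⇒m≤1+n (≤-trans (ℕₚ.n≤1+n _) g)) a w
  Win-exchange (move A g a w) = move A (s≤s g) a w

  Win? : ∀ m i r {k} (p : Vec Pair k) → Dec (Win m i r p)
  Win? m i zero p = map′ diff (λ { (diff d) → d }) (Diff? p)
  Win? m i (suc r) p = map′ fro to (Diff? p ⊎-dec Step? E ⊎-dec Step? A)
    where
    Step : Quantifier → Set
    -- By monotonicity the largest remaining budget is as good as any other `j`.
    Step q = cost m q ≤ i × ∃[ a ] ∀ b → Win (just q) (i ∸ cost m q) r (pair q a b ∷ p)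

    Step? : ∀ q → Dec (Step q)
    Step? q = (cost m q ≤? i) ×-dec any? λ a → all? λ b → Win? _ _ r _

    step : ∀ q → Step q → Win m i (suc r) p
    step q (h , a , w) = move q (≤-reflexive (ℕₚ.m+[n∸m]≡n h)) a w

    fro : Diff p ⊎ Step E ⊎ Step A → Win m i (suc r) p
    fro = [ diff , [ step E , step A ]′ ]′

    unstep : ∀ q {j} → cost m q + j ≤ i → ∀ a →
             (∀ b → Win (just q) j r (pair q a b ∷ p)) → Step q
    unstep q {j} g a w = ℕₚ.m+n≤o⇒m≤o _ g , a , λ b → Win-≤ (begin
        j                        ≡⟨ ℕₚ.m+n∸m≡n (cost m q) j ⟨
        cost m q + j ∸ cost m q  ≤⟨ ℕₚ.∸-monoˡ-≤ (cost m q) g ⟩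
        i ∸ cost m q             ∎) ≤-refl (w b)
      where open ℕₚ.≤-Reasoning

    to : Win m i (suc r) p → Diff p ⊎ Step E ⊎ Step A
    to (diff d)       = inj₁ d
    to (move E g a w) = inj₂ (inj₁ (unstep E g a w))
    to (move A g a w) = inj₂ (inj₂ (unstep A g a w))

  cost-same : ∀ q → cost (just q) q ≡ 0
  cost-same E = refl
  cost-same A = refl

  pairs : Quantifier → ∀ {m} → Vec (Fin n) m → Vec (Fin n) m → Vec Pair m
  pairs q = Vec.zipWith (pair q)

  moves : ∀ q {i r k m} {p : Vec Pair k} (as : Vec (Fin n) m) →
    (∀ bs → Win (just q) i r (pairs q as bs Vec.++ p)) → Win (just q) i (m + r) p
  moves q []       w = w []
  moves q {i} {r} {m = suc m} {p} (a ∷ as) w =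
    subst (λ l → Win (just q) i l p) (ℕₚ.+-suc m r)
      -- `a` is played last, so that its pair lands in front of the others by computation.
      (moves q as λ bs → move q (≤-reflexive (cong (_+ i) (cost-same q))) a λ b → w (b ∷ bs))

-- Spoiler's strategy

-- Colors stand for isomorphism types of ordered pairs: they record whether the two elements are
-- equal and determine the color of the reversed pair.
module Core {n : ℕ} {Col : Set} (_≟_ : DecidableEquality Col)
  (c : Quantifier → Fin n → Fin n → Col)
  (c-≡ : ∀ s s′ {u v u′ v′} → c s u v ≡ c s′ u′ v′ → u ≡ v → u′ ≡ v′)
  (c-swap : ∀ s s′ {u v u′ v′} → c s u v ≡ c s′ u′ v′ → c s v u ≡ c s′ v′ u′)
  where

  open Game _≟_ c

  _≟s_ : DecidableEquality (List Col)
  _≟s_ = Listₚ.≡-dec _≟_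

  type : Quantifier → List (Fin n) → Fin n → List Col
  type s X u = c s u u ∷ map (λ x → c s x u) X

  open Transversals _≟s_

  -- Growing a homogeneous base

  Homogeneous : (Fin n → List Col) → Set
  Homogeneous τ = ∀ x w u v → x ≢ w → τ x ≡ τ w → τ u ≡ τ v → u ≢ x → v ≢ x → c E x u ≡ c E x v

  module Splitting (X : List (Fin n)) (L : List (Fin n)) (tr : Transversal (type E X) L)
    (x : Fin n) where

    τ τ′ : Fin n → List Col
    τ  = type E X
    τ′ = type E (x ∷ X)

    refine : ∀ {u v} → τ′ u ≡ τ′ v → τ u ≡ τ v
    refine e = cong₂ _∷_ (Listₚ.∷-injectiveˡ e) (Listₚ.∷-injectiveʳ (Listₚ.∷-injectiveʳ e))

    refine-c : ∀ {u v} → τ′ u ≡ τ′ v → c E x u ≡ c E x v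
    refine-c e = Listₚ.∷-injectiveˡ (Listₚ.∷-injectiveʳ e)

    -- The color of `(x , u)` tells whether `u` is `x`, so `x` becomes a class of its own once it
    -- belongs to the base.
    isolated : ∀ {u} → u ≢ x → τ′ x ≢ τ′ u
    isolated ne e = ne (sym (c-≡ E E (refine-c e) refl))

    rep-∈ : ∀ u → Σ[ r ∈ Fin n ] (r ∈ L × τ u ≡ τ r)
    rep-∈ u = ∈-map⁻ τ (proj₂ tr u)

    rep : Fin n → Fin n
    rep u = proj₁ (rep-∈ u)

    rep-type : ∀ u → τ u ≡ τ (rep u)
    rep-type u = proj₂ (proj₂ (rep-∈ u))

    rep-cong : ∀ {u v} → τ u ≡ τ v → rep u ≡ rep v
    rep-cong {u} {v} e = Unique-map-injective τ (proj₁ tr) (proj₁ (proj₂ (rep-∈ u)))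
      (proj₁ (proj₂ (rep-∈ v))) (trans (sym (rep-type u)) (trans e (rep-type v)))

    unique′ : Unique (map τ′ L)
    unique′ = AllPairsₚ.map⁺ (AllPairs.map (λ ne e → ne (refine e))
                (AllPairsₚ.map⁻ (proj₁ tr)))

    -- Refined classes lie inside old ones, so the only member of `L` that could share the refined
    -- class of `y` is `rep y`.
    fresh : ∀ {y} → τ′ y ≢ τ′ (rep y) → All (τ′ y ≢_) (map τ′ L)
    fresh {y} ne = Allₚ.map⁺ (All.tabulate λ {p} p∈ e → ne (trans e (cong τ′
      (Unique-map-injective τ (proj₁ tr) p∈ (proj₁ (proj₂ (rep-∈ y)))
        (trans (sym (refine e)) (rep-type y))))))

    Enlarged : Set
    Enlarged = Σ[ L′ ∈ List (Fin n) ] (Unique (map τ′ L′) × length L′ ≡ 2 + length L)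

    enlarge : ∀ y₁ y₂ → τ′ y₁ ≢ τ′ (rep y₁) → τ′ y₂ ≢ τ′ (rep y₂) → τ′ y₁ ≢ τ′ y₂ → Enlarged
    enlarge y₁ y₂ n₁ n₂ n₁₂ =
      y₁ ∷ y₂ ∷ L , (n₁₂ ∷ fresh n₁) ∷ fresh n₂ ∷ unique′ , refl

    -- Two elements must leave the refined classes of `L`. If `x` is not its own representative,
    -- these are `x` and one of `u`, `v`. If it is, and `u` lies in its class, then `u` and `v` both
    -- part from `x` and from each other. Otherwise they are `w`, which parts from its
    -- representative `x`, and one of `u`, `v`.
    split : ∀ w u v → x ≢ w → τ x ≡ τ w → τ u ≡ τ v → u ≢ x → v ≢ x → c E x u ≢ c E x v → Enlarged
    split w u v x≢w xw uv u≢x v≢x ne = cases (rep x Fin.≟ x) (τ x ≟s τ u)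
      where
      new-∈ : Σ[ y ∈ Fin n ] (τ′ y ≢ τ′ (rep y) × y ≢ x × τ y ≡ τ u)
      -- `u` and `v` share a representative and are separated by `x`, so at least one of them leaves
      -- it.
      new-∈ with τ′ u ≟s τ′ (rep u)
      ... | no  n₁ = u , n₁ , u≢x , refl
      ... | yes e  = v , (λ e′ → ne (refine-c (trans e (trans (cong τ′ (rep-cong uv)) (sym e′)))))
                   , v≢x , sym uv

      cases : Dec (rep x ≡ x) → Dec (τ x ≡ τ u) → Enlarged
      cases (no rx≢x) _ with new-∈
      ... | y , ny , y≢x , _ = enlarge x y (isolated rx≢x) ny (isolated y≢x)
      cases (yes rx≡x) (yes xu) = enlarge u v
        (λ e → isolated u≢x (trans (cong τ′ (trans (sym rx≡x) (rep-cong xu))) (sym e)))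
        (λ e → isolated v≢x (trans (cong τ′ (trans (sym rx≡x) (rep-cong (trans xu uv)))) (sym e)))
        (ne ∘ refine-c)
      cases (yes rx≡x) (no ¬xu) with new-∈
      ... | y , ny , _ , yu = enlarge w y
        (λ e → isolated (x≢w ∘ sym) (trans (cong τ′ (trans (sym rx≡x) (rep-cong xw))) (sym e)))
        ny (λ e → ¬xu (trans xw (trans (refine e) yu)))

  Splits : (Fin n → List Col) → Set
  Splits τ = ∃[ x ] ∃[ w ] ∃[ u ] ∃[ v ]
    (x ≢ w × τ x ≡ τ w × τ u ≡ τ v × u ≢ x × v ≢ x × c E x u ≢ c E x v)

  splits? : ∀ τ → Dec (Splits τ)
  splits? τ = any? λ x → any? λ w → any? λ u → any? λ v →
    ¬? (x Fin.≟ w) ×-dec (τ x ≟s τ w) ×-dec (τ u ≟s τ v) ×-dec ¬? (u Fin.≟ x)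
      ×-dec ¬? (v Fin.≟ x) ×-dec ¬? (c E x u ≟ c E x v)

  ¬splits⇒Homogeneous : ∀ {τ} → ¬ Splits τ → Homogeneous τ
  ¬splits⇒Homogeneous ¬s x w u v a b d e f with c E x u ≟ c E x v
  ... | yes eq = eq
  ... | no  ne = contradiction (x , w , u , v , a , b , d , e , f , ne) ¬s

  record Base : Set where
    field
      X           : List (Fin n)
      homogeneous : Homogeneous (type E X)
      L           : List (Fin n)
      distinct    : Unique (map (type E X) L)
      many        : suc (2 * length X) ≤ length L

  -- One new element of `X` buys at least two new classes, which preserves the bound on `length L`.
  -- As there are at most `n` classes, the fuel cannot run out.
  greedy : ∀ fuel (X L : List (Fin n)) → Transversal (type E X) L → suc (2 * length X) ≤ length L →
    n < fuel + length L → Base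
  greedy zero X L tr many lt =
    contradiction (Unique-length≤ (Uniqueₚ.map⁻ (proj₁ tr))) (ℕₚ.<⇒≱ lt)
  greedy (suc fuel) X L tr many lt with splits? (type E X)
  ... | no ¬s = record { X = X ; homogeneous = ¬splits⇒Homogeneous ¬s ; L = L
                       ; distinct = proj₁ tr ; many = many }
  ... | yes (x , w , u , v , a , b , d , e , f , ne)
    with Splitting.split X L tr x w u v a b d e f ne
  ...   | L′ , u′ , len with transversal (type E (x ∷ X)) L′ u′
  ...     | L″ , tr″ , l = greedy fuel (x ∷ X) L″ tr″ many″ (≤-trans lt lt″)
    where
    open ℕₚ.≤-Reasoning
    two-more : 2 + length L ≤ length L″
    two-more = ≤-trans (≤-reflexive (sym len)) l
    many″ : suc (2 * length (x ∷ X)) ≤ length L″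
    many″ = begin
      suc (2 * suc (length X))     ≡⟨ cong suc (ℕₚ.*-suc 2 (length X)) ⟩
      2 + suc (2 * length X)       ≤⟨ ℕₚ.+-monoʳ-≤ 2 many ⟩
      2 + length L                 ≤⟨ two-more ⟩
      length L″                    ∎
    lt″ : suc fuel + length L ≤ fuel + length L″
    lt″ = begin
      suc fuel + length L          ≡⟨ ℕₚ.+-suc fuel (length L) ⟨
      fuel + suc (length L)        ≤⟨ ℕₚ.+-monoʳ-≤ fuel (≤-trans (ℕₚ.n≤1+n _) two-more) ⟩
      fuel + length L″             ∎

  -- The class of `v` is the 1 in `suc (2 * length X)` when `X` is still empty.
  base : Fin n → Base
  base v with transversal (type E []) (v ∷ []) ([] ∷ [])
  ... | L , tr , l = greedy (suc n) [] L tr l (ℕₚ.m≤m+n (suc n) (length L))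

  -- Types over a position and outnumbering

  _∈ᵖ_ : ∀ {k} → Pair → Vec Pair k → Set
  x ∈ᵖ p = ∃[ i ] lookup p i ≡ x

  κ : ∀ {k} → Vec Pair k → Quantifier → Fin n → List Col
  κ p s = type s (map (side s) (Vec.toList p))

  κ-diag : ∀ {k} (p : Vec Pair k) s s′ {u u′} → κ p s u ≡ κ p s′ u′ → c s u u ≡ c s′ u′ u′
  κ-diag p s s′ e = Listₚ.∷-injectiveˡ e

  agree : ∀ {k} (p : Vec Pair k) → ¬ Diff p → ∀ {x y} → x ∈ᵖ p → y ∈ᵖ p →
    c E (proj₁ x) (proj₁ y) ≡ c A (proj₂ x) (proj₂ y)
  agree p ¬d (i , refl) (j , refl) with c E _ _ ≟ c A _ _
  ... | yes e = e
  ... | no ne = contradiction (i , j , ne) ¬d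

  agree-side : ∀ {k} (p : Vec Pair k) → ¬ Diff p → ∀ q {x y} → x ∈ᵖ p → y ∈ᵖ p →
    c q (side q x) (side q y) ≡ c (exchange q) (side (exchange q) x) (side (exchange q) y)
  agree-side p ¬d E x y = agree p ¬d x y
  agree-side p ¬d A x y = sym (agree p ¬d x y)

  _⊑_ : ∀ {k k′} → Vec Pair k → Vec Pair k′ → Set
  p ⊑ p′ = ∀ i → lookup p i ∈ᵖ p′

  -- Each entry of the two types is the color of pairs pebbled in `p′`, where no difference has
  -- appeared yet.
  κ-agree : ∀ {k k′} (p : Vec Pair k) (p′ : Vec Pair k′) → p ⊑ p′ → ¬ Diff p′ →
    ∀ {x} → x ∈ᵖ p′ → κ p E (proj₁ x) ≡ κ p A (proj₂ x)
  κ-agree p p′ sub ¬d {x} x∈ = cong₂ _∷_ (agree p′ ¬d x∈ x∈) (columns p sub)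
    where
    columns : ∀ {k} (p : Vec Pair k) → p ⊑ p′ →
      map (λ z → c E z (proj₁ x)) (map proj₁ (Vec.toList p)) ≡
      map (λ z → c A z (proj₂ x)) (map proj₂ (Vec.toList p))
    columns []      sub = refl
    columns (y ∷ p) sub = cong₂ _∷_ (agree p′ ¬d (sub Fin.zero) x∈) (columns p (sub ∘ Fin.suc))

  side-pair : ∀ q a b → side q (pair q a b) ≡ a
  side-pair E a b = refl
  side-pair A a b = refl

  side-exchange-pair : ∀ q a b → side (exchange q) (pair q a b) ≡ b
  side-exchange-pair E a b = refl
  side-exchange-pair A a b = refl

  module _ {K : Set} (_≟K_ : DecidableEquality K) where
    open Fibres _≟K_

    -- Spoiler plays one element more of the fibre over τ than there are on
    -- the other side, so two answers coincide or one lies outside.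
    outnumber : ∀ q {l r k} {p : Vec Pair k} (f g : Fin n → K) (τ : K) →
      # g τ (allFin n) < # f τ (allFin n) →
      (∀ {k′} {p′ : Vec Pair k′} a b → p ⊑ p′ → pair q a b ∈ᵖ p′ → f a ≡ τ → g b ≢ τ →
        Win (just q) l r p′) →
      Win (just q) l (suc (# g τ (allFin n)) + r) p
    outnumber q {l} {r} {k} {p} f g τ lt win = moves q as answer
      where
      m = suc (# g τ (allFin n))
      as-at : Fin m → Fin n
      as-at i = List.lookup (fibre f τ (allFin n)) (Fin.inject≤ i lt)
      as : Vec (Fin n) m
      as = Vec.tabulate as-at
      f-as : ∀ i → f (as-at i) ≡ τ
      f-as i = proj₂ (∈-filter⁻ (λ x → f x ≟K τ) {xs = allFin n} (∈-lookup (Fin.inject≤ i lt)))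
      as-injective : ∀ i j → as-at i ≡ as-at j → i ≡ j
      as-injective i j e = Finₚ.inject≤-injective lt lt i j
        (lookup-injective (Uniqueₚ.filter⁺ (λ x → f x ≟K τ) (Uniqueₚ.allFin⁺ n)) _ _ e)

      module _ (bs : Vec (Fin n) m) where
        p′ = pairs q as bs Vec.++ p

        new : ∀ i → pair q (as-at i) (lookup bs i) ∈ᵖ p′
        new i = i Fin.↑ˡ k , trans (Vecₚ.lookup-++ˡ (pairs q as bs) p i)
          (trans (Vecₚ.lookup-zipWith (pair q) i as bs)
                 (cong (λ a → pair q a (lookup bs i)) (Vecₚ.lookup∘tabulate as-at i)))

        old : p ⊑ p′
        old i = m Fin.↑ʳ i , Vecₚ.lookup-++ʳ (pairs q as bs) p i

        collide : (∀ i → g (lookup bs i) ≡ τ) → Diff p′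
        collide all with Diff? p′
        ... | yes d = d
        ... | no ¬d = contradiction
          (as-injective i j (c-≡ (exchange q) q (sym same) bs-eq)) (Finₚ.<⇒≢ i<j)
          where
          bs-∈ : ∀ i → lookup bs i ∈ fibre g τ (allFin n)
          bs-∈ i = ∈-filter⁺ (λ x → g x ≟K τ) (∈-allFin _) (all i)
          hole = Finₚ.pigeonhole (ℕₚ.n<1+n _) (λ i → Any.index (bs-∈ i))
          i = proj₁ hole
          j = proj₁ (proj₂ hole)
          i<j = proj₁ (proj₂ (proj₂ hole))
          bs-eq : lookup bs i ≡ lookup bs j
          bs-eq = trans (Anyₚ.lookup-index (bs-∈ i)) (trans
            (cong (List.lookup (fibre g τ (allFin n))) (proj₂ (proj₂ (proj₂ hole))))
            (sym (Anyₚ.lookup-index (bs-∈ j))))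
          same : c q (as-at i) (as-at j) ≡ c (exchange q) (lookup bs i) (lookup bs j)
          same = subst₂ _≡_ (cong₂ (c q) (side-pair q _ _) (side-pair q _ _))
            (cong₂ (c (exchange q)) (side-exchange-pair q _ _) (side-exchange-pair q _ _))
            (agree-side p′ ¬d q (new i) (new j))

        answer : Win (just q) l r p′
        answer with all? (λ i → g (lookup bs i) ≟K τ)
        ... | yes all = diff (collide all)
        ... | no ¬all with Finₚ.¬∀⟶∃¬ m _ (λ i → g (lookup bs i) ≟K τ) ¬all
        ...   | i , out = win {p′ = p′} _ _ old (new i) (f-as i) out

  Embedding : Set
  Embedding = Σ[ π ∈ (Fin n → Fin n) ] (∀ u v → c E u v ≡ c A (π u) (π v))

  -- The endgame after the base has been played

  module Endgame {k} (p : Vec Pair k) (homogeneous : Homogeneous (κ p E))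
    (L : List (Fin n)) (distinct : Unique (map (κ p E) L)) (many : suc (2 * k) ≤ length L)
    (r : ℕ) (enough : n + 2 ≤ 2 * (k + r)) where

    private
      τ : Quantifier → Fin n → List Col
      τ = κ p

    -- With `R = k + r` rounds in all, `2 * (k + x) ≤ n + 3 ≤ 2 * R + 1`, and by parity `k + x ≤ R`.
    fit : ∀ x → 2 * (k + x) ≤ n + 3 → x ≤ r
    fit x h with x ≤? r
    ... | yes x≤r = x≤r
    ... | no  x≰r = contradiction h (ℕₚ.<⇒≱ (begin-strict
        n + 3                ≡⟨ ℕₚ.+-suc n 2 ⟩
        suc (n + 2)          ≤⟨ s≤s enough ⟩
        suc (2 * (k + r))    <⟨ ℕₚ.n<1+n _ ⟩
        2 + 2 * (k + r)      ≡⟨ ℕₚ.*-suc 2 (k + r) ⟨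
        2 * suc (k + r)      ≡⟨ cong (2 *_) (ℕₚ.+-suc k r) ⟨
        2 * (k + suc r)      ≤⟨ ℕₚ.*-monoʳ-≤ 2 (ℕₚ.+-monoʳ-≤ k (ℕₚ.≰⇒> x≰r)) ⟩
        2 * (k + x)          ∎))
      where open ℕₚ.≤-Reasoning

    module _ {K : Set} (_≟K_ : DecidableEquality K) where
      open Fibres _≟K_

      -- Two fibres of opposite excess: Spoiler plays where fewer elements
      -- have to be exceeded.
      outnumber-smaller : (f g : Fin n → K) {τ₁ τ₂ : K} (e : ℕ) →
        # g τ₁ (allFin n) < # f τ₁ (allFin n) → # f τ₂ (allFin n) < # g τ₂ (allFin n) →
        # f τ₁ (allFin n) + # f τ₂ (allFin n) + length L + (e + e) ≤ n + 3 →
        (∀ q {i} → cost (just q) A ≤ i → ∀ {k′} {p′ : Vec Pair k′} x → p ⊑ p′ → x ∈ᵖ p′ →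
          f (proj₁ x) ≢ g (proj₂ x) → Win (just q) i e p′) →
        Win (just E) 1 r p
      outnumber-smaller f g {τ₁} {τ₂} e lt₁ lt₂ bound finish =
        choose (ℕₚ.≤-total (# g τ₁ (allFin n)) (# f τ₂ (allFin n)))
        where
        open ℕₚ.≤-Reasoning
        open +-*-Solver using (solve; _:+_; _:*_; _:=_; con)

        -- Twice the number of rounds splits into `suc m`, `m`, `suc (2 * k)` and `e + e`. The first
        -- two are bounded by the two fibres in G, and the classes in `L` pay for the pebbles of the
        -- base.
        affordable : ∀ m → m ≤ # g τ₁ (allFin n) → m ≤ # f τ₂ (allFin n) → suc m + e ≤ r
        affordable m l₁ l₂ = fit (suc m + e) (begin
          2 * (k + (suc m + e))
            ≡⟨ solve 3 (λ k m e → con 2 :* (k :+ (con 1 :+ m :+ e)) :=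
                 con 1 :+ m :+ m :+ (con 1 :+ con 2 :* k) :+ (e :+ e)) refl k m e ⟩
          suc m + m + suc (2 * k) + (e + e)
            ≤⟨ ℕₚ.+-monoˡ-≤ (e + e) (ℕₚ.+-mono-≤ (ℕₚ.+-mono-≤ (≤-trans (s≤s l₁) lt₁) l₂) many) ⟩
          # f τ₁ (allFin n) + # f τ₂ (allFin n) + length L + (e + e)
            ≤⟨ bound ⟩
          n + 3 ∎)

        choose : # g τ₁ (allFin n) ≤ # f τ₂ (allFin n) ⊎ # f τ₂ (allFin n) ≤ # g τ₁ (allFin n) →
          Win (just E) 1 r p
        -- All these moves are in G, so the alternation is kept for a finishing move in G′.
        choose (inj₁ l) = Win-≤ ≤-refl (affordable _ ≤-refl l)
          (outnumber _≟K_ E f g τ₁ lt₁ λ a b sub ab∈ fa gb →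
            finish E ≤-refl (a , b) sub ab∈ (λ eq → gb (trans (sym eq) fa)))
        -- The alternation is spent on turning to G′, where a finishing move is then free.
        choose (inj₂ l) = Win-≤ ≤-refl (affordable _ l ≤-refl) (Win-exchange
          (outnumber _≟K_ A g f τ₂ lt₂ λ a b sub ba∈ ga fb →
            finish A z≤n (b , a) sub ba∈ (λ eq → fb (trans eq ga))))

    -- Duplicator's answer z′ to z, or z to z′, survives one more move in the structure s.
    Compatible : Quantifier → Fin n → Fin n → Set
    Compatible s z z′ = τ E z ≡ τ s z′ × (∀ w′ → ∃[ w ] (τ E w ≡ τ s w′ × c E z w ≡ c s z′ w′))

    compatible? : ∀ s z z′ → Dec (Compatible s z z′)
    compatible? s z z′ = (τ E z ≟s τ s z′) ×-dec
      all? λ w′ → any? λ w → (τ E w ≟s τ s w′) ×-dec (c E z w ≟ c s z′ w′)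

    compatible-refl : ∀ z → Compatible E z z
    compatible-refl z = refl , λ w → w , refl , refl

    compatible-trans : ∀ {s z₂ z z′} → Compatible E z₂ z → Compatible s z z′ → Compatible s z₂ z′
    compatible-trans (t₂ , m₂) (t , m) = trans t₂ t , λ w′ →
      let w , tw , cw = m w′
          w₂ , tw₂ , cw₂ = m₂ w
      in w₂ , trans tw₂ tw , trans cw₂ cw

    Companion : Fin n → Set
    Companion z = ∃[ w ] (z ≢ w × τ E z ≡ τ E w)

    companion? : ∀ z → Dec (Companion z)
    companion? z = any? λ w → ¬? (z Fin.≟ w) ×-dec (τ E z ≟s τ E w)

    lonely : ∀ {z w} → ¬ Companion z → τ E z ≡ τ E w → z ≡ w
    lonely {z} {w} ¬c e with z Fin.≟ w
    ... | yes z≡w = z≡w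
    ... | no  z≢w = contradiction (w , z≢w , e) ¬c

    homogeneous′ : ∀ {z u v} → Companion z → τ E u ≡ τ E v → u ≢ z → v ≢ z → c E z u ≡ c E z v
    homogeneous′ {z} {u} {v} (w , z≢w , e) = homogeneous z w u v z≢w e

    TypePreserving : Quantifier → Set
    TypePreserving s = Σ[ π ∈ (Fin n → Fin n) ] (Injective _≡_ _≡_ π × (∀ u → τ s (π u) ≡ τ E u))

    identity : TypePreserving E
    identity = id , id , λ _ → refl

    -- `π w` may be `z′` itself; then `z` and `w` have the same type and `π z` serves instead.
    translate : ∀ {s z z′} → TypePreserving s → τ E z ≡ τ s z′ → ∀ w → w ≢ z →
      ∃[ w′ ] (z′ ≢ w′ × τ s w′ ≡ τ E w)
    translate {s} {z} {z′} (π , inj , pres) e w w≢z with z′ Fin.≟ π w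
    ... | no  ne = π w , ne , pres w
    ... | yes eq = π z , (λ eq′ → w≢z (inj (trans (sym eq) eq′))) ,
                   trans (pres z) (trans e (trans (cong (τ s) eq) (pres w)))

    -- If `z` has no companion, then `z₂` is `z`. Otherwise, for `w` other than `z`, take `w′` other
    -- than `z′` with the type of `w`. The replies of `z` and `z₂` to `w′` have equal colors, and
    -- homogeneity replaces the reply of `z` by `w`.
    compatible-euclid : ∀ {s z₂ z z′} → TypePreserving s → Compatible s z₂ z′ → Compatible s z z′ →
      Compatible E z₂ z
    compatible-euclid {s} {z₂} {z} {z′} π (t₂ , m₂) (t , m) = t₂z , answer (companion? z)
      where
      t₂z : τ E z₂ ≡ τ E z
      t₂z = trans t₂ (sym t)
      answer : Dec (Companion z) → ∀ w → ∃[ w₂ ] (τ E w₂ ≡ τ E w × c E z₂ w₂ ≡ c E z w)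
      answer (no ¬c) w = w , refl , cong (λ y → c E y w) (sym (lonely ¬c (sym t₂z)))
      answer (yes cz) w with w Fin.≟ z
      ... | yes refl = z₂ , t₂z , κ-diag p E E t₂z
      ... | no w≢z with translate π t w w≢z
      ...   | w′ , z′≢w′ , tw′ with m w′ | m₂ w′
      ...     | w₃ , t₃ , c₃ | w₂ , tw₂ , cw₂ = w₂ , trans tw₂ tw′ , trans cw₂ (trans (sym c₃)
                (homogeneous′ cz (trans t₃ tw′) (λ w₃≡z → z′≢w′ (c-≡ E s c₃ (sym w₃≡z))) w≢z))

    -- Compatibility with z′ depends on z′ only through its first compatible
    -- element of G, so it amounts to equality of keys.
    key : Quantifier → Fin n → Maybe (Fin n)
    key s z′ = List.head (filter (λ z → compatible? s z z′) (allFin n))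

    key-just : ∀ s z′ {y} → key s z′ ≡ just y → Compatible s y z′
    key-just s z′ {y} e = proj₂ (∈-filter⁻ (λ z → compatible? s z z′) {xs = allFin n} (head-∈ _ e))
      where
      head-∈ : ∀ xs → List.head xs ≡ just y → y ∈ xs
      head-∈ (x ∷ xs) refl = here refl

    key-E : ∀ z → ∃[ y ] key E z ≡ just y
    key-E z = head-of (∈-filter⁺ (λ y → compatible? E y z) (∈-allFin z) (compatible-refl z))
      where
      head-of : ∀ {xs} → z ∈ xs → ∃[ y ] List.head xs ≡ just y
      head-of {x ∷ xs} _ = x , refl

    -- The key of `z` in G is never `nothing`, so equal keys name a common compatible element `y`;
    -- on G compatibility can be reversed, which leads from `z` through `y` to `z′`.
    key⇒compatible : ∀ {s z z′} → key E z ≡ key s z′ → Compatible s z z′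
    key⇒compatible {s} {z} {z′} e with key-E z
    ... | y , ey = compatible-trans
      (compatible-euclid identity (compatible-refl z) (key-just E z ey))
      (key-just s z′ (trans (sym e) ey))

    compatible⇒key : ∀ {s z z′} → TypePreserving s → Compatible s z z′ → key E z ≡ key s z′
    compatible⇒key {s} {z} {z′} π zz′ = cong List.head
      (Listₚ.filter-≐ (λ y → compatible? E y z) (λ y → compatible? s y z′)
        ((λ yz → compatible-trans yz zz′) , (λ yz′ → compatible-euclid π yz′ zz′)) (allFin n))

    profile : Quantifier → Fin n → List Col × Maybe (Fin n)
    profile s z = τ s z , key s z

    _≟p_ : DecidableEquality (List Col × Maybe (Fin n))
    _≟p_ = ×ₚ.≡-dec _≟s_ (Maybeₚ.≡-dec Fin._≟_)

    -- Compatibility of `u` answers `π v` by some `w` of the type of `v`, and `w` has to be replaced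
    -- by `v`. Homogeneity does this if `u` has a companion; if only `v` has one, the pair is
    -- reversed; if neither has, `w` is `v`.
    compatible⇒embedding : (π : Fin n → Fin n) → Injective _≡_ _≡_ π →
      (∀ u → Compatible A u (π u)) → Embedding
    compatible⇒embedding π inj comp = π , preserved
      where
      from-companion : ∀ {u v} → Companion u → u ≢ v → c E u v ≡ c A (π u) (π v)
      from-companion {u} {v} cu u≢v with proj₂ (comp u) (π v)
      ... | w , tw , cw = trans (homogeneous′ cu (trans (proj₁ (comp v)) (sym tw)) (u≢v ∘ sym)
                            (λ w≡u → u≢v (inj (c-≡ E A cw (sym w≡u))))) cw

      preserved : ∀ u v → c E u v ≡ c A (π u) (π v)
      preserved u v with u Fin.≟ v | companion? u | companion? v
      ... | yes refl | _      | _      = κ-diag p E A (proj₁ (comp u))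
      ... | no u≢v   | yes cu | _      = from-companion cu u≢v
      ... | no u≢v   | no _   | yes cv = c-swap E A (from-companion cv (u≢v ∘ sym))
      ... | no u≢v   | no _   | no ¬cv with proj₂ (comp u) (π v)
      ...   | w , tw , cw = trans (cong (c E u) (lonely ¬cv (trans (proj₁ (comp v)) (sym tw)))) cw

    finish-type : ∀ q {i} → cost (just q) A ≤ i → ∀ {k′} {p′ : Vec Pair k′} x → p ⊑ p′ → x ∈ᵖ p′ →
      τ E (proj₁ x) ≢ τ A (proj₂ x) → Win (just q) i 0 p′
    finish-type q _ {p′ = p′} x sub x∈ ne with Diff? p′
    ... | yes d = diff d
    ... | no ¬d = contradiction (κ-agree p p′ sub ¬d x∈) ne

    -- If the types agree, different profiles mean incompatibility, so some `w′` has no good reply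
    -- in G and Spoiler plays it.
    finish-profile : TypePreserving A → ∀ q {i} → cost (just q) A ≤ i →
      ∀ {k′} {p′ : Vec Pair k′} x → p ⊑ p′ → x ∈ᵖ p′ →
      profile E (proj₁ x) ≢ profile A (proj₂ x) → Win (just q) i 1 p′
    finish-profile π q h {p′ = p′} x@(z , z′) sub x∈ ne with Diff? p′
    ... | yes d = diff d
    ... | no ¬d with Finₚ.¬∀⟶∃¬ n _ (λ w′ → any? λ w → (τ E w ≟s τ A w′) ×-dec (c E z w ≟ c A z′ w′))
                      (λ all → ne (cong₂ _,_ same-type (compatible⇒key π (same-type , all))))
      where
      same-type : τ E z ≡ τ A z′
      same-type = κ-agree p p′ sub ¬d x∈
    ...   | w′ , none = move A (≤-trans (≤-reflexive (ℕₚ.+-identityʳ _)) h) w′ λ w → diff (refute w)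
      where
      refute : ∀ w → Diff ((w , w′) ∷ p′)
      refute w with Diff? ((w , w′) ∷ p′)
      ... | yes d = d
      ... | no ¬d′ = contradiction
        (w , κ-agree p ((w , w′) ∷ p′) (λ i → Fin.suc (proj₁ (sub i)) , proj₂ (sub i)) ¬d′
               (Fin.zero , refl)
           , agree ((w , w′) ∷ p′) ¬d′ (Fin.suc (proj₁ x∈) , proj₂ x∈) (Fin.zero , refl)) none

    -- Counting classes and profiles

    private
      module T = Fibres _≟s_
      module P = Fibres _≟p_

    avoid : (γ : List Col) (L : List (Fin n)) → List (Fin n)
    avoid γ = filter (λ u → ¬? (τ E u ≟s γ))

    avoid-distinct : ∀ γ {L} → Unique (map (τ E) L) → Unique (map (τ E) (avoid γ L))
    avoid-distinct γ u = AllPairsₚ.map⁺ (AllPairsₚ.filter⁺ _ (AllPairsₚ.map⁻ u))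

    avoid-≢ : ∀ γ {L} {u} → u ∈ avoid γ L → u ∈ L × τ E u ≢ γ
    avoid-≢ γ {L} u∈ = ∈-filter⁻ (λ u → ¬? (τ E u ≟s γ)) {xs = L} u∈

    -- Avoiding two classes costs `L` at most two members, so the count is at most `n + 2`; a
    -- difference of types needs no further move.
    types-unbalanced : (∃[ σ ] T.# (τ A) σ (allFin n) < T.# (τ E) σ (allFin n)) →
      (∃[ σ ] T.# (τ E) σ (allFin n) < T.# (τ A) σ (allFin n)) → Win (just E) 1 r p
    types-unbalanced (σ₁ , lt₁) (σ₂ , lt₂) =
      outnumber-smaller _≟s_ (τ E) (τ A) 0 lt₁ lt₂ bound finish-type
      where
      open ℕₚ.≤-Reasoning
      L₁ = avoid σ₁ L
      L₂ = avoid σ₂ L₁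
      s = T.# (τ E) σ₁ (allFin n) + T.# (τ E) σ₂ (allFin n)
      few : s + length L₂ ≤ n
      few = two-fibres (τ E) (λ { refl → ℕₚ.<-asym lt₁ lt₂ }) L₂
        (Uniqueₚ.map⁻ (avoid-distinct σ₂ (avoid-distinct σ₁ distinct)))
        (All.tabulate λ u∈ → let u∈L₁ , ne₂ = avoid-≢ σ₂ {L₁} u∈ in
          proj₂ (avoid-≢ σ₁ {L} u∈L₁) , ne₂)
      bound : s + length L + 0 ≤ n + 3
      bound = begin
        s + length L + 0         ≡⟨ ℕₚ.+-identityʳ _ ⟩
        s + length L             ≤⟨ ℕₚ.+-monoʳ-≤ s (≤-trans (Unique-avoid (τ E) σ₁ L distinct)
                                     (s≤s (Unique-avoid (τ E) σ₂ L₁ (avoid-distinct σ₁ distinct)))) ⟩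
        s + (2 + length L₂)      ≡⟨ ℕₚ.+-assoc s 2 _ ⟨
        s + 2 + length L₂        ≡⟨ cong (_+ length L₂) (ℕₚ.+-comm s 2) ⟩
        2 + (s + length L₂)      ≤⟨ ℕₚ.+-monoʳ-≤ 2 few ⟩
        2 + n                    ≡⟨ ℕₚ.+-comm 2 n ⟩
        n + 2                    ≤⟨ ℕₚ.+-monoʳ-≤ n (ℕₚ.n≤1+n 2) ⟩
        n + 3                    ∎

    -- The finishing move adds 2 to the doubled count. As both profiles belong to one class, `L`
    -- loses at most one member, and the total `n + 1 + 2` just fits.
    profiles-unbalanced : TypePreserving A → ∀ {σ₁ σ₂} → proj₁ σ₁ ≡ proj₁ σ₂ →
      P.# (profile A) σ₁ (allFin n) < P.# (profile E) σ₁ (allFin n) →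
      P.# (profile E) σ₂ (allFin n) < P.# (profile A) σ₂ (allFin n) → Win (just E) 1 r p
    profiles-unbalanced π {σ₁} {σ₂} same lt₁ lt₂ =
      outnumber-smaller _≟p_ (profile E) (profile A) 1 lt₁ lt₂ bound (finish-profile π)
      where
      open ℕₚ.≤-Reasoning
      open Transversals _≟p_ using () renaming (two-fibres to two-fibres-p)
      L₁ = avoid (proj₁ σ₁) L
      s = P.# (profile E) σ₁ (allFin n) + P.# (profile E) σ₂ (allFin n)
      few : s + length L₁ ≤ n
      few = two-fibres-p (profile E) (λ { refl → ℕₚ.<-asym lt₁ lt₂ }) L₁
        (Uniqueₚ.map⁻ (avoid-distinct (proj₁ σ₁) distinct))
        (All.tabulate λ u∈ → let ne = proj₂ (avoid-≢ (proj₁ σ₁) {L} u∈) in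
          (λ e → ne (cong proj₁ e)) , (λ e → ne (trans (cong proj₁ e) (sym same))))
      bound : s + length L + 2 ≤ n + 3
      bound = begin
        s + length L + 2         ≤⟨ ℕₚ.+-monoˡ-≤ 2
                                     (ℕₚ.+-monoʳ-≤ s (Unique-avoid (τ E) (proj₁ σ₁) L distinct)) ⟩
        s + suc (length L₁) + 2  ≡⟨ cong (_+ 2) (ℕₚ.+-suc s (length L₁)) ⟩
        suc (s + length L₁) + 2  ≤⟨ ℕₚ.+-monoˡ-≤ 2 (s≤s few) ⟩
        suc n + 2                ≡⟨ ℕₚ.+-suc n 2 ⟨
        n + 3                    ∎

    within-type : ∀ s γ {σ} → proj₁ σ ≡ γ →
      P.# (profile s) σ (T.fibre (τ s) γ (allFin n)) ≡ P.# (profile s) σ (allFin n)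
    within-type s γ {σ} e = cong length (filter-filter-⊆ (λ u → profile s u ≟p σ) (λ u → τ s u ≟s γ)
      (λ eq → trans (cong proj₁ eq) e) (allFin n))

    nonempty-type : ∀ s γ {σ m} → m < P.# (profile s) σ (T.fibre (τ s) γ (allFin n)) → proj₁ σ ≡ γ
    nonempty-type s γ {σ} lt = in-fibre _ refl lt
      where
      in-fibre : ∀ {m} xs → P.fibre (profile s) σ (T.fibre (τ s) γ (allFin n)) ≡ xs →
        m < length xs → proj₁ σ ≡ γ
      in-fibre (x ∷ xs) e _
        with ∈-filter⁻ (λ u → profile s u ≟p σ) {xs = T.fibre (τ s) γ (allFin n)}
               (subst (x ∈_) (sym e) (here refl))
      ... | x∈ , eq = trans (sym (cong proj₁ eq))
                        (proj₂ (∈-filter⁻ (λ u → τ s u ≟s γ) {xs = allFin n} x∈))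

    win-or-embed : Win (just E) 1 r p ⊎ Embedding
    win-or-embed with T.balance (τ E) (τ A) (allFin n) (allFin n) refl
    ... | inj₂ (more , less) = inj₁ (types-unbalanced more less)
    ... | inj₁ m with Matched⇒injection _≟s_ m
                    | P.balance (profile E) (profile A) (allFin n) (allFin n) refl
    ...   | π | inj₁ m′ = inj₂ (compatible⇒embedding (proj₁ ρ) (proj₁ (proj₂ ρ))
              λ u → key⇒compatible (sym (cong proj₂ (proj₂ (proj₂ ρ) u))))
      where
      ρ : Σ[ ρ ∈ (Fin n → Fin n) ] (Injective _≡_ _≡_ ρ × (∀ u → profile A (ρ u) ≡ profile E u))
      ρ = Matched⇒injection _≟p_ m′
    -- The two unbalanced profiles may belong to different classes. Balancing again inside `γ`,
    -- which has the same size on both sides, finds two within this class.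
    ...   | π | inj₂ ((σ@(γ , _) , lt) , _)
      with P.balance (profile E) (profile A) (T.fibre (τ E) γ (allFin n)) (T.fibre (τ A) γ (allFin n))
             (T.Matched⇒#≡ m γ)
    ...     | inj₁ m′ = contradiction lt (ℕₚ.<-irrefl (sym (trans (sym (within-type E γ refl))
                          (trans (P.Matched⇒#≡ m′ σ) (within-type A γ refl)))))
    ...     | inj₂ ((σ₁ , lt₁) , (σ₂ , lt₂)) = inj₁ (profiles-unbalanced π (trans in₁ (sym in₂))
                (subst₂ _<_ (within-type A γ in₁) (within-type E γ in₁) lt₁)
                (subst₂ _<_ (within-type E γ in₂) (within-type A γ in₂) lt₂))
      where
      in₁ : proj₁ σ₁ ≡ γ
      in₁ = nonempty-type E γ lt₁
      in₂ : proj₁ σ₂ ≡ γ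
      in₂ = nonempty-type A γ lt₂

  toList-proj₁ : ∀ X (bs : Vec (Fin n) (length X)) →
      map proj₁ (Vec.toList (pairs E (Vec.fromList X) bs Vec.++ [])) ≡ X
  toList-proj₁ []      []       = refl
  toList-proj₁ (x ∷ X) (b ∷ bs) = cong (x ∷_) (toList-proj₁ X bs)

  -- The empty universe embeds trivially, so there is an element to start the base from.
  element : ¬ Embedding → Fin n
  element ¬emb with empty-or-inhabited n
  ... | inj₁ empty = contradiction (id , λ u → ⊥-elim (empty u)) ¬emb
  ... | inj₂ v     = v

  spoiler-wins : ¬ Embedding → ∀ R → n + 2 ≤ 2 * R → Win nothing 1 R []
  spoiler-wins ¬emb R enough = Win-nothing (subst (λ r → Win (just E) 1 r []) (ℕₚ.m+[n∸m]≡n k≤R)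
    (moves E {p = []} (Vec.fromList X) after))
    where
    open Base (base (element ¬emb))
    r = R ∸ length X
    k≤R : length X ≤ R
    -- `2 * length X` is less than the number of classes, which is at most `n`.
    k≤R = ℕₚ.*-cancelˡ-≤ 2 (≤-trans (≤-trans (ℕₚ.n≤1+n _)
            (≤-trans many (Unique-length≤ (Uniqueₚ.map⁻ distinct)))) (≤-trans (ℕₚ.m≤m+n n 2) enough))
    after : ∀ bs → Win (just E) 1 r (pairs E (Vec.fromList X) bs Vec.++ [])
    after bs with Endgame.win-or-embed (pairs E (Vec.fromList X) bs Vec.++ [])
                    (subst (λ Y → Homogeneous (type E Y)) (sym X≡) homogeneous) L
                    (subst (λ Y → Unique (map (type E Y) L)) (sym X≡) distinct)
                    (subst (λ k → suc (2 * k) ≤ length L) (sym (ℕₚ.+-identityʳ (length X))) many)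
                    r (≤-trans enough (≤-reflexive (cong (2 *_) (trans (sym (ℕₚ.m+[n∸m]≡n k≤R))
                        (cong (_+ r) (sym (ℕₚ.+-identityʳ (length X))))))))
      where
      X≡ : map proj₁ (Vec.toList (pairs E (Vec.fromList X) bs Vec.++ [])) ≡ X
      X≡ = toList-proj₁ X bs
    ... | inj₁ win = win
    ... | inj₂ emb = contradiction emb ¬emb

-- Colors of pairs in a structure

module Structures (V : Vocabulary) (arity≤2 : ∀ R → arity V R ≤ 2) {n : ℕ}
  (S : Quantifier → Structure V n) where

  -- A relation symbol with two variables in its argument places: a relational atom about a pair.
  Test : Set
  Test = Σ[ R ∈ Fin (size V) ] Vec (Fin 2) (arity V R)

  tests : List Test
  tests = List.concatMap (λ R → map (R ,_) (vectors 2 (arity V R))) (allFin (size V))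

  ∈-tests : ∀ t → t ∈ tests
  ∈-tests (R , ys) = ∈-concat⁺′ (∈-map⁺ (R ,_) (∈-vectors ys)) (∈-map⁺ _ (∈-allFin R))

  test : Quantifier → Fin n → Fin n → Test → Bool
  test s u v (R , ys) = rel (S s) R (Vec.map (lookup (u ∷ v ∷ [])) ys)

  -- The isomorphism type of (u , v).
  color : Quantifier → Fin n → Fin n → List Bool
  color s u v = does (u Fin.≟ v) ∷ map (test s u v) tests

  color-≡ : ∀ s s′ {u v u′ v′} → color s u v ≡ color s′ u′ v′ → u ≡ v → u′ ≡ v′
  color-≡ s s′ e = does-≡ (_ Fin.≟ _) (_ Fin.≟ _) (Listₚ.∷-injectiveˡ e)

  color-test : ∀ s s′ {u v u′ v′} → color s u v ≡ color s′ u′ v′ → ∀ t → test s u v t ≡ test s′ u′ v′ t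
  color-test s s′ e t = map-≡⇒≗ (Listₚ.∷-injectiveʳ e) (∈-tests t)

  opposite : Fin 2 → Fin 2
  opposite Fin.zero    = Fin.suc Fin.zero
  opposite (Fin.suc _) = Fin.zero

  test-swap : ∀ s u v R ys → test s v u (R , ys) ≡ test s u v (R , Vec.map opposite ys)
  test-swap s u v R ys = cong (rel (S s) R) (trans (Vecₚ.map-cong
    (λ { Fin.zero → refl ; (Fin.suc Fin.zero) → refl }) ys)
    (Vecₚ.map-∘ (lookup (u ∷ v ∷ [])) opposite ys))

  -- Reversing the pair renames the two variables, and `tests` contains the renamed tests too.
  color-swap : ∀ s s′ {u v u′ v′} → color s u v ≡ color s′ u′ v′ → color s v u ≡ color s′ v′ u′
  color-swap s s′ {u} {v} {u′} {v′} e = cong₂ _∷_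
    (≡-does (v Fin.≟ u) (v′ Fin.≟ u′) (sym ∘ color-≡ s s′ e ∘ sym) (sym ∘ color-≡ s′ s (sym e) ∘ sym))
    (Listₚ.map-cong (λ (R , ys) → trans (test-swap s u v R ys)
      (trans (color-test s s′ e (R , Vec.map opposite ys)) (sym (test-swap s′ u′ v′ R ys)))) tests)

  _≟c_ : DecidableEquality (List Bool)
  _≟c_ = Listₚ.≡-dec Boolₚ._≟_

  open Game _≟c_ color public
  open Core _≟c_ color color-≡ color-swap public using (Embedding; agree-side; spoiler-wins)

  embedding⇒isomorphism : Embedding → Isomorphism (S E) (S A)
  embedding⇒isomorphism (π , pres) = record { bijection = proj₁ φ ; preserves = preserves }
    where
    φ = injective⇒↔ π (λ {u} {v} e → color-≡ A E (sym (pres u v)) e)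
    preserves : ∀ R xs → rel (S E) R xs ≡ rel (S A) R (Vec.map (Inverse.to (proj₁ φ)) xs)
    preserves R xs with factor (arity≤2 R) (positive V R) xs
    ... | u , v , ys , refl = trans (color-test E A (pres u v) (R , ys))
      (cong (rel (S A) R) (sym (trans (Vecₚ.map-cong (proj₂ φ) _) (map-pair π u v ys))))

  Sat? : ∀ s {k} (ρ : Vec (Fin n) k) Φ → Dec (Sat (S s) ρ Φ)
  Sat? s ρ (x ≈ y)     = lookup ρ x Fin.≟ lookup ρ y
  Sat? s ρ (atom R xs) = T? _
  Sat? s ρ (neg Φ)     = ¬? (Sat? s ρ Φ)
  Sat? s ρ (Φ and Ψ)   = Sat? s ρ Φ ×-dec Sat? s ρ Ψ
  Sat? s ρ (Φ or Ψ)    = Sat? s ρ Φ ⊎-dec Sat? s ρ Ψ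
  Sat? s ρ (exists′ Φ) = any? λ a → Sat? s (a ∷ ρ) Φ
  Sat? s ρ (forall′ Φ) = all? λ a → Sat? s (a ∷ ρ) Φ

  assign : Quantifier → ∀ {k} → Vec Pair k → Vec (Fin n) k
  assign s = Vec.map (side s)

-- Formulas and the game

alternationsAfter : Maybe Quantifier → Word → ℕ
alternationsAfter nothing  w = alternations w
alternationsAfter (just q) w = alternations (q ∷ w)

alternationsAfter-[] : ∀ m → alternationsAfter m [] ≡ 0
alternationsAfter-[] nothing  = refl
alternationsAfter-[] (just E) = refl
alternationsAfter-[] (just A) = refl

alternationsAfter-∷ : ∀ m q w → alternationsAfter m (q ∷ w) ≡ cost m q + alternationsAfter (just q) w
alternationsAfter-∷ nothing  q w = refl
alternationsAfter-∷ (just E) E w = refl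
alternationsAfter-∷ (just E) A w = refl
alternationsAfter-∷ (just A) E w = refl
alternationsAfter-∷ (just A) A w = refl

-- Words as they stand when a formula is used positively (E) or negated (A).
polarize : Quantifier → Word → Word
polarize E = id
polarize A = map exchange

exchange-involutive : ∀ w → map exchange (map exchange w) ≡ w
exchange-involutive []      = refl
exchange-involutive (E ∷ w) = cong (E ∷_) (exchange-involutive w)
exchange-involutive (A ∷ w) = cong (A ∷_) (exchange-involutive w)

Within : Maybe Quantifier → ℕ → ℕ → Word → Set
Within m i r w = length w ≤ r × alternationsAfter m w ≤ i

Nest-nonempty : ∀ {V k} (Φ : Formula V k) → ∃[ w ] w ∈ Nest Φ
Nest-nonempty (x ≈ y)     = [] , here refl
Nest-nonempty (atom R xs) = [] , here refl
Nest-nonempty (neg Φ)     = _ , ∈-map⁺ (map exchange) (proj₂ (Nest-nonempty Φ))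
Nest-nonempty (Φ and Ψ)   = _ , ∈-++⁺ˡ (proj₂ (Nest-nonempty Φ))
Nest-nonempty (Φ or Ψ)    = _ , ∈-++⁺ˡ (proj₂ (Nest-nonempty Φ))
Nest-nonempty (exists′ Φ) = _ , ∈-map⁺ (E ∷_) (proj₂ (Nest-nonempty Φ))
Nest-nonempty (forall′ Φ) = _ , ∈-map⁺ (A ∷_) (proj₂ (Nest-nonempty Φ))

module Correspondence (V : Vocabulary) (arity≤2 : ∀ R → arity V R ≤ 2) {n : ℕ}
  (S : Quantifier → Structure V n) where

  open Structures V arity≤2 S

  -- From formulas to wins

  Afford : Maybe Quantifier → ℕ → ℕ → Quantifier → (Word → Word) → List Word → Set
  Afford m i r q f ws = ∃[ r′ ] ∃[ j ] (r ≡ suc r′ × cost m q + j ≤ i ×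
    All (λ w → Within (just q) j r′ (f w)) ws)

  -- The word `w₀` guarantees that a round and `cost m q` alternations are left; for an empty list
  -- the bounds would hold vacuously.
  afford : ∀ m {i r} q (f : Word → Word) {w₀ ws} → w₀ ∈ ws →
    All (λ w → Within m i r (q ∷ f w)) ws → Afford m i r q f ws
  afford m {i} {r} q f {w₀} {ws} w₀∈ h = split r (All.lookup h w₀∈) h
    where
    split : ∀ r → Within m i r (q ∷ f w₀) → All (λ w → Within m i r (q ∷ f w)) ws → Afford m i r q f ws
    split (suc r) (_ , b₀) h = r , i ∸ cost m q , refl ,
      ≤-reflexive (ℕₚ.m+[n∸m]≡n (ℕₚ.m+n≤o⇒m≤o (cost m q)
        (subst (_≤ i) (alternationsAfter-∷ m q (f w₀)) b₀))) ,
      All.map (λ {w} (l , b) → ℕ.s≤s⁻¹ l , ℕₚ.m+n≤o⇒m≤o∸n _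
        (subst (_≤ i) (trans (alternationsAfter-∷ m q (f w)) (ℕₚ.+-comm (cost m q) _)) b)) h

  agree-color : ∀ {k} (p : Vec Pair k) → ¬ Diff p → ∀ s i j →
    color s (lookup (assign s p) i) (lookup (assign s p) j) ≡
    color (exchange s) (lookup (assign (exchange s) p) i) (lookup (assign (exchange s) p) j)
  agree-color p ¬d s i j = subst₂ _≡_
    (sym (color-assign s)) (sym (color-assign (exchange s)))
    (agree-side p ¬d s (i , refl) (j , refl))
    where
    color-assign : ∀ q → color q (lookup (assign q p) i) (lookup (assign q p) j) ≡
      color q (side q (lookup p i)) (side q (lookup p j))
    color-assign q = cong₂ (color q) (Vecₚ.lookup-map i (side q) p) (Vecₚ.lookup-map j (side q) p)

  -- Spoiler follows the formula, with `s` naming the structure in which the current subformula is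
  -- true. Negation flips `s`, hence the polarized words. Spoiler plays a witness of a true
  -- existential or a counterexample to a false universal formula.
  formula⇒win : ∀ {k} (Φ : Formula V k) s {m i r} (p : Vec Pair k) →
    All (λ w → Within m i r (polarize s w)) (Nest Φ) →
    Sat (S s) (assign s p) Φ → ¬ Sat (S (exchange s)) (assign (exchange s) p) Φ → Win m i r p
  formula⇒win (x ≈ y) s p _ sat unsat with Diff? p
  ... | yes d = diff d
  ... | no ¬d = contradiction (color-≡ s (exchange s) (agree-color p ¬d s x y) sat) unsat
  formula⇒win (atom R xs) s p _ sat unsat with Diff? p | factor (arity≤2 R) (positive V R) xs
  ... | yes d | _ = diff d
  ... | no ¬d | i , j , ys , refl = contradiction (subst T
    (trans (cong (rel (S s) R) (map-pair (lookup (assign s p)) i j ys))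
    (trans (color-test s (exchange s) (agree-color p ¬d s i j) (R , ys))
           (cong (rel (S (exchange s)) R)
             (sym (map-pair (lookup (assign (exchange s) p)) i j ys))))) sat) unsat
  formula⇒win (neg Φ) E p ws sat unsat = formula⇒win Φ A p (Allₚ.map⁻ ws)
    (decidable-stable (Sat? A (assign A p) Φ) unsat) sat
  formula⇒win (neg Φ) A {m} {i} {r} p ws sat unsat = formula⇒win Φ E p
    (All.map (λ {w} → subst (Within m i r) (exchange-involutive w)) (Allₚ.map⁻ ws))
    (decidable-stable (Sat? E (assign E p) Φ) unsat) sat
  formula⇒win (Φ and Ψ) s p ws (satΦ , satΨ) unsat
    with Sat? (exchange s) (assign (exchange s) p) Φ
  ... | no ¬Φ = formula⇒win Φ s p (Allₚ.++⁻ˡ (Nest Φ) ws) satΦ ¬Φ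
  ... | yes Φ′ = formula⇒win Ψ s p (Allₚ.++⁻ʳ (Nest Φ) ws) satΨ (λ Ψ′ → unsat (Φ′ , Ψ′))
  formula⇒win (Φ or Ψ) s p ws (inj₁ satΦ) unsat =
    formula⇒win Φ s p (Allₚ.++⁻ˡ (Nest Φ) ws) satΦ (unsat ∘ inj₁)
  formula⇒win (Φ or Ψ) s p ws (inj₂ satΨ) unsat =
    formula⇒win Ψ s p (Allₚ.++⁻ʳ (Nest Φ) ws) satΨ (unsat ∘ inj₂)
  formula⇒win (exists′ Φ) E {m} p ws (a , sat) unsat
    with afford m E id (proj₂ (Nest-nonempty Φ)) (Allₚ.map⁻ ws)
  ... | r , j , refl , c , ws′
      = move E c a λ b → formula⇒win Φ E ((a , b) ∷ p) ws′ sat (λ s → unsat (b , s))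
  formula⇒win (exists′ Φ) A {m} p ws (b , sat) unsat
    with afford m A (map exchange) (proj₂ (Nest-nonempty Φ)) (Allₚ.map⁻ ws)
  ... | r , j , refl , c , ws′
      = move A c b λ a → formula⇒win Φ A ((a , b) ∷ p) ws′ sat (λ s → unsat (a , s))
  formula⇒win (forall′ Φ) E {m} p ws sat unsat
    with afford m A id (proj₂ (Nest-nonempty Φ)) (Allₚ.map⁻ ws)
       | Finₚ.¬∀⟶∃¬ n _ (λ b → Sat? A (b ∷ assign A p) Φ) unsat
  ... | r , j , refl , c , ws′ | b , ¬b
      = move A c b λ a → formula⇒win Φ E ((a , b) ∷ p) ws′ (sat a) ¬b
  formula⇒win (forall′ Φ) A {m} p ws sat unsat
    with afford m E (map exchange) (proj₂ (Nest-nonempty Φ)) (Allₚ.map⁻ ws)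
       | Finₚ.¬∀⟶∃¬ n _ (λ a → Sat? E (a ∷ assign E p) Φ) unsat
  ... | r , j , refl , c , ws′ | a , ¬a
      = move E c a λ b → formula⇒win Φ A ((a , b) ∷ p) ws′ (sat b) ¬a

  -- From wins to formulas

  Separator : Maybe Quantifier → ℕ → ℕ → ∀ {k} → Vec Pair k → Set
  Separator m i r {k} p = Σ[ Φ ∈ Formula V k ] (All (Within m i r) (Nest Φ) ×
    Sat (S E) (assign E p) Φ × ¬ Sat (S A) (assign A p) Φ)

  -- A variable is in scope, so the empty conjunction and disjunction can be written without truth
  -- constants.
  ⋀ ⋁ : ∀ {k l} → (Fin l → Formula V (suc k)) → Formula V (suc k)
  ⋀ {l = zero}  Φ = Fin.zero ≈ Fin.zero
  ⋀ {l = suc l} Φ = Φ Fin.zero and ⋀ (Φ ∘ Fin.suc)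
  ⋁ {l = zero}  Φ = neg (Fin.zero ≈ Fin.zero)
  ⋁ {l = suc l} Φ = Φ Fin.zero or ⋁ (Φ ∘ Fin.suc)

  module _ {P : Word → Set} (P[] : P []) where
    Nest-⋀ : ∀ {k l} (Φ : Fin l → Formula V (suc k)) → (∀ b → All P (Nest (Φ b))) → All P (Nest (⋀ Φ))
    Nest-⋀ {l = zero}  Φ h = P[] ∷ []
    Nest-⋀ {l = suc l} Φ h = Allₚ.++⁺ (h Fin.zero) (Nest-⋀ (Φ ∘ Fin.suc) (h ∘ Fin.suc))

    Nest-⋁ : ∀ {k l} (Φ : Fin l → Formula V (suc k)) → (∀ b → All P (Nest (Φ b))) → All P (Nest (⋁ Φ))
    Nest-⋁ {l = zero}  Φ h = P[] ∷ []
    Nest-⋁ {l = suc l} Φ h = Allₚ.++⁺ (h Fin.zero) (Nest-⋁ (Φ ∘ Fin.suc) (h ∘ Fin.suc))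

  Sat-⋀⁺ : ∀ {G : Structure V n} {k l} {ρ} (Φ : Fin l → Formula V (suc k)) →
   (∀ b → Sat G ρ (Φ b)) → Sat G ρ (⋀ Φ)
  Sat-⋀⁺ {l = zero}  Φ h = refl
  Sat-⋀⁺ {l = suc l} Φ h = h Fin.zero , Sat-⋀⁺ (Φ ∘ Fin.suc) (h ∘ Fin.suc)

  Sat-⋀⁻ : ∀ {G : Structure V n} {k l} {ρ} (Φ : Fin l → Formula V (suc k)) →
   Sat G ρ (⋀ Φ) → ∀ b → Sat G ρ (Φ b)
  Sat-⋀⁻ Φ (s , _) Fin.zero    = s
  Sat-⋀⁻ Φ (_ , s) (Fin.suc b) = Sat-⋀⁻ (Φ ∘ Fin.suc) s b

  Sat-⋁⁺ : ∀ {G : Structure V n} {k l} {ρ} (Φ : Fin l → Formula V (suc k))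
    b → Sat G ρ (Φ b) → Sat G ρ (⋁ Φ)
  Sat-⋁⁺ Φ Fin.zero    s = inj₁ s
  Sat-⋁⁺ Φ (Fin.suc b) s = inj₂ (Sat-⋁⁺ (Φ ∘ Fin.suc) b s)

  Sat-⋁⁻ : ∀ {G : Structure V n} {k l} {ρ} (Φ : Fin l → Formula V (suc k)) →
   Sat G ρ (⋁ Φ) → ∃[ b ] Sat G ρ (Φ b)
  Sat-⋁⁻ {l = zero}  Φ s        = contradiction refl s
  Sat-⋁⁻ {l = suc l} Φ (inj₁ s) = Fin.zero , s
  Sat-⋁⁻ {l = suc l} Φ (inj₂ s) = let b , s′ = Sat-⋁⁻ (Φ ∘ Fin.suc) s in Fin.suc b , s′

  within-[] : ∀ m {i r} → Within m i r []
  within-[] m = z≤n , ≤-trans (≤-reflexive (alternationsAfter-[] m)) z≤n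

  within-∷ : ∀ m q {i j r w} → cost m q + j ≤ i → Within (just q) j r w → Within m i (suc r) (q ∷ w)
  within-∷ m q {w = w} c (l , b) = s≤s l ,
    ≤-trans (≤-reflexive (alternationsAfter-∷ m q w)) (≤-trans (ℕₚ.+-monoʳ-≤ (cost m q) b) c)

  -- Different colors disagree on equality or on a test, and that atom or its negation separates
  -- without quantifiers.
  diff⇒separator : ∀ {m i r k} {p : Vec Pair k} → Diff p → Separator m i r p
  diff⇒separator {m} {p = p} (x , y , ne) = by-equality (u Fin.≟ v) (u′ Fin.≟ v′)
    where
    u = lookup (assign E p) x
    v = lookup (assign E p) y
    u′ = lookup (assign A p) x
    v′ = lookup (assign A p) y

    atomic : (R : Fin (size V)) → Vec (Fin 2) (arity V R) → Formula V _
    atomic R ys = atom R (Vec.map (lookup (x ∷ y ∷ [])) ys)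

    sat-atomic : ∀ s R ys → Sat (S s) (assign s p) (atomic R ys) ≡
      T (test s (lookup (assign s p) x) (lookup (assign s p) y) (R , ys))
    sat-atomic s R ys = cong (T ∘ rel (S s) R) (map-pair (lookup (assign s p)) x y ys)

    by-test : ∀ t → Dec (T (test E u v t)) → Dec (T (test A u′ v′ t)) →
      test E u v t ≢ test A u′ v′ t → Separator m _ _ p
    by-test (R , ys) (yes t) (no ¬t) _ = atomic R ys , within-[] m ∷ [] ,
      subst id (sym (sat-atomic E R ys)) t , ¬t ∘ subst id (sat-atomic A R ys)
    by-test (R , ys) (no ¬t) (yes t) _ = neg (atomic R ys) , within-[] m ∷ [] ,
      ¬t ∘ subst id (sat-atomic E R ys) , λ ¬s → ¬s (subst id (sym (sat-atomic A R ys)) t)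
    by-test (R , ys) (yes t) (yes t′) ne =
      contradiction (trans (Equivalence.to Boolₚ.T-≡ t) (sym (Equivalence.to Boolₚ.T-≡ t′))) ne
    by-test (R , ys) (no ¬t) (no ¬t′) ne =
      contradiction (trans (¬T⇒≡false ¬t) (sym (¬T⇒≡false ¬t′))) ne
      where
      ¬T⇒≡false : ∀ {b} → ¬ T b → b ≡ false
      ¬T⇒≡false {false} _ = refl
      ¬T⇒≡false {true}  h = contradiction _ h

    colors-differ : color E u v ≢ color A u′ v′
    colors-differ e = ne (subst₂ _≡_
      (cong₂ (color E) (Vecₚ.lookup-map x (side E) p) (Vecₚ.lookup-map y (side E) p))
      (cong₂ (color A) (Vecₚ.lookup-map x (side A) p) (Vecₚ.lookup-map y (side A) p)) e)

    by-tests : (u ≡ v → u′ ≡ v′) → (u′ ≡ v′ → u ≡ v) → Separator m _ _ p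
    by-tests to from with Any.any? (λ t → ¬? (test E u v t Boolₚ.≟ test A u′ v′ t)) tests
    ... | yes some = let t , _ , ne = find some in by-test t (T? _) (T? _) ne
    ... | no none = contradiction
      (cong₂ _∷_ (≡-does (u Fin.≟ v) (u′ Fin.≟ v′) to from)
        (Listₚ.map-cong-local (All.map (decidable-stable (_ Boolₚ.≟ _)) (Allₚ.¬Any⇒All¬ tests none))))
      colors-differ

    by-equality : Dec (u ≡ v) → Dec (u′ ≡ v′) → Separator m _ _ p
    by-equality (yes e) (no ¬e) = x ≈ y , within-[] m ∷ [] , e , ¬e
    by-equality (no ¬e) (yes e) = neg (x ≈ y) , within-[] m ∷ [] , ¬e , λ h → h e
    by-equality (yes e) (yes e′) = by-tests (λ _ → e′) (λ _ → e)
    by-equality (no ¬e) (no ¬e′) = by-tests (⊥-elim ∘ ¬e) (⊥-elim ∘ ¬e′)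

  -- A move in G becomes an existential quantifier over the conjunction of the separators for all
  -- replies; a move in G′ becomes, dually, a universal quantifier over a disjunction.
  win⇒separator : ∀ {m i r k} {p : Vec Pair k} → Win m i r p → Separator m i r p
  win⇒separator {m} (diff d) = diff⇒separator {m} d
  win⇒separator {m} (move E c a w) =
    exists′ (⋀ (proj₁ ∘ sep)) ,
    Allₚ.map⁺ (All.map (within-∷ m E c) (Nest-⋀ (within-[] (just E)) _ (λ b → proj₁ (proj₂ (sep b))))) ,
    (a , Sat-⋀⁺ _ (λ b → proj₁ (proj₂ (proj₂ (sep b))))) ,
    λ (b , s) → proj₂ (proj₂ (proj₂ (sep b))) (Sat-⋀⁻ _ s b)
    where
    sep : ∀ b → Separator (just E) _ _ _
    sep b = win⇒separator (w b)
  win⇒separator {m} (move A c b w) =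
    forall′ (⋁ (proj₁ ∘ sep)) ,
    Allₚ.map⁺ (All.map (within-∷ m A c) (Nest-⋁ (within-[] (just A)) _ (λ a → proj₁ (proj₂ (sep a))))) ,
    (λ a → Sat-⋁⁺ _ a (proj₁ (proj₂ (proj₂ (sep a))))) ,
    λ s → let a , s′ = Sat-⋁⁻ _ (s b) in proj₂ (proj₂ (proj₂ (sep a))) s′
    where
    sep : ∀ a → Separator (just A) _ _ _
    sep a = win⇒separator (w a)

  -- Minimum rank as the least number of rounds

  within⇒rank : ∀ {i r} (Φ : ClosedFormula V) → All (Within nothing i r) (Nest Φ) →
    quantifierRank Φ ≤ r × alternationNumber Φ ≤ i
  within⇒rank Φ h = max≤v⁺ z≤n (Allₚ.map⁺ (All.map proj₁ h)) , max≤v⁺ z≤n (Allₚ.map⁺ (All.map proj₂ h))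

  rank⇒within : ∀ {i} (Φ : ClosedFormula V) → alternationNumber Φ ≤ i →
    All (Within nothing i (quantifierRank Φ)) (Nest Φ)
  rank⇒within Φ h = All.zip (Allₚ.map⁻ (xs≤max 0 (map length (Nest Φ))) ,
    All.map (λ b → ≤-trans b h) (Allₚ.map⁻ (xs≤max 0 (map alternations (Nest Φ)))))

  distinguishes⇒win : ∀ {i} (Φ : ClosedFormula V) → alternationNumber Φ ≤ i →
    Distinguishes Φ (S E) (S A) → Win nothing i (quantifierRank Φ) []
  distinguishes⇒win Φ h (sat , unsat) = formula⇒win Φ E [] (rank⇒within Φ h) sat unsat

  -- `Win` is decidable and monotone in the number of rounds, so descending to the first failure
  -- finds the least one.
  least-win : ∀ {i} R → Win nothing i R [] →
    ∃[ d ] (d ≤ R × Win nothing i d [] × (∀ r → Win nothing i r [] → d ≤ r))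
  least-win zero win = zero , z≤n , win , λ _ _ → z≤n
  least-win {i} (suc R) win with Win? nothing i R []
  ... | yes win′ = let d , d≤R , w , least = least-win R win′ in d , m≤n⇒m≤1+n d≤R , w , least
  ... | no ¬win = suc R , ≤-refl , win , λ r w → ℕₚ.≰⇒> (λ r≤R → ¬win (Win-≤ ≤-refl r≤R w))

  -- The formula read off from a shortest win has rank at most `d`, and every distinguishing formula
  -- yields a win in as many rounds as its rank.
  win⇒IsD : ∀ {i} R → Win nothing i R [] → ∃[ d ] (IsD i (S E) (S A) d × d ≤ R)
  win⇒IsD R win with least-win R win
  ... | d , d≤R , w , least with win⇒separator w
  ...   | Φ , within , sat , unsat = d , record
    { attained = Φ , alt≤ , (sat , unsat) , ℕₚ.≤-antisym (proj₁ (within⇒rank Φ within))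
                   (least _ (distinguishes⇒win Φ alt≤ (sat , unsat)))
    ; minimal  = λ Ψ h dist → least _ (distinguishes⇒win Ψ h dist) } , d≤R
    where
    alt≤ = proj₂ (within⇒rank Φ within)

-- `R` is half of `n + 2`, rounded up: enough for Spoiler and within the bound claimed.
half : ∀ n → ∃[ R ] (n + 2 ≤ 2 * R × 2 * R ≤ n + 3)
half zero          = 1 , ≤-refl , ℕₚ.n≤1+n 2
half (suc zero)    = 2 , ℕₚ.n≤1+n 3 , ≤-refl
half (suc (suc n)) = let R , l , u = half n in suc R ,
  subst (2 + (n + 2) ≤_) (sym (ℕₚ.*-suc 2 R)) (s≤s (s≤s l)) ,
  subst (_≤ 2 + (n + 3)) (sym (ℕₚ.*-suc 2 R)) (s≤s (s≤s u))

theorem8p2 : (V : Vocabulary) → (∀ (R : Fin (size V)) → arity V R ≤ 2) →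
    (n : ℕ) (G G′ : Structure V n) → ¬ Isomorphism G G′ →
    ∃[ d ] (IsD 1 G G′ d × 2 * d ≤ n + 3)
theorem8p2 V arity≤2 n G G′ ¬iso =
  let R , enough , small = half n
      d , isD , d≤R = win⇒IsD R (spoiler-wins (¬iso ∘ embedding⇒isomorphism) R enough)
  in d , isD , ≤-trans (ℕₚ.*-monoʳ-≤ 2 d≤R) small
  where
  S : Quantifier → Structure V n
  S E = G
  S A = G′
  open Structures V arity≤2 S
  open Correspondence V arity≤2 S
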